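{- Let $n\geq k\geq 6$ be integers and let $G$ be an edge-colored graph on $n$ vertices such that $m(G)+c(G)=\binom{n}{2}+t_{n,k-2}+1$ and $G$ does not contain a rainbow $K_k$. Then $G\in\mathcal{H}_k$.
   Context: Graphs are finite, simple and undirected. An edge-colored graph is a graph together with an arbitrary (not necessarily proper) assignment of a color to each edge. $m(G)$ denotes the number of edges of $G$, and $c(G)$ the number of distinct colors that actually appear on the edges of $G$. A subgraph is rainbow if all its edges have pairwise distinct colors. For $q\le n$, the Turán graph $T_{n,q}$ is the complete $q$-partite graph on $n$ vertices whose partite sets have sizes as equal as possible (each of size $\lfloor n/q\rfloor$ or $\lceil n/q\rceil$), and $t_{n,q}$ denotes its number of edges. $H_{n,q}$ denotes the edge-colored complete graph on $n$ vertices with a spanning subgraph $T_{n,q}$ whose edges all receive pairwise different colors, and in which all remaining edges (those inside the partite sets of $T_{n,q}$) are colored alike with one further color not used on $T_{n,q}$. Isomorphism of edge-colored graphs is understood up to renaming of colors. $\mathcal{H}_k$ is the set of all edge-colored graphs $H$ such that, with $n$ the number of vertices of $H$, either (I) $H$ is isomorphic to $H_{n,k-2}$, or (II) $\lfloor n/(k-2)\rfloor=1$, $H$ is complete, $c(H)=t_{n,k-2}+1$, and $H$ contains a rainbow $T_{n,k-2}$ as a subgraph but no rainbow $K_k$. -}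

module Defs where

open import Data.Fin using (Fin; toℕ; _<?_)
open import Data.Fin.Permutation using (Permutation′; _⟨$⟩ʳ_)
import Data.Fin.Properties as Fin
open import Data.List using (List; length; map; filter; deduplicate; allFin; cartesianProduct)
open import Data.Maybe using (Maybe; just; nothing)
import Data.Maybe.Properties as Maybe
open import Data.Nat using (ℕ; _+_; _∸_; _≤_; s≤s; _⊓_; _⊔_; NonZero)
open import Data.Nat.DivMod using (_/_; _%_)
import Data.Nat.Properties as ℕ
open import Data.Product using (_×_; _,_; uncurry)
import Data.Product.Properties as Product
open import Data.Sum using (_⊎_)
open import Function using (_∘_; _⇔_; Injective)
open import Relation.Binary using (Decidable; DecidableEquality; Symmetric)
open import Relation.Binary.PropositionalEquality using (_≡_; _≢_; refl; sym; cong; cong₂)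
open import Relation.Nullary using (¬_; yes; no; contradiction; ¬?; _×-dec_)

private
  variable
    m n : ℕ

record Graph (n : ℕ) : Set₁ where
  field
    Adj        : Fin n → Fin n → Set
    adj?       : Decidable Adj
    adj-sym    : Symmetric Adj
    adj-irrefl : ∀ {v} → ¬ Adj v v

  -- Each edge is listed once, with its smaller endpoint first.
  edges : List (Fin n × Fin n)
  edges = filter (λ (u , v) → (u <? v) ×-dec adj? u v)
                 (cartesianProduct (allFin n) (allFin n))

-- `color` is total for convenience; only its values on adjacent pairs are
-- part of the colored graph, and nothing below looks at the others.
record EdgeColoredGraph (n : ℕ) : Set₁ where
  field
    graph     : Graph n
    Color     : Set
    _≟_       : DecidableEquality Color
    color     : Fin n → Fin n → Color
    color-sym : ∀ u v → color u v ≡ color v u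

  open Graph graph public

  m[_] : ℕ
  m[_] = length edges

  c[_] : ℕ
  c[_] = length (deduplicate _≟_ (map (uncurry color) edges))

open EdgeColoredGraph public using (m[_]; c[_])

K : (n : ℕ) → Graph n
K n = record
  { Adj        = _≢_
  ; adj?       = λ u v → ¬? (u Fin.≟ v)
  ; adj-sym    = λ u≢v → u≢v ∘ sym
  ; adj-irrefl = λ v≢v → v≢v refl
  }

-- The partite sets are the residue classes modulo q of 0, …, n - 1; each has
-- ⌊n/q⌋ or ⌈n/q⌉ elements.
part : (q : ℕ) .{{_ : NonZero q}} → Fin n → ℕ
part q v = toℕ v % q

T : (n q : ℕ) .{{_ : NonZero q}} → Graph n
T n q = record
  { Adj        = λ u v → part q u ≢ part q v
  ; adj?       = λ u v → ¬? (part q u ℕ.≟ part q v)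
  ; adj-sym    = λ u≢v → u≢v ∘ sym
  ; adj-irrefl = λ v≢v → v≢v refl
  }

t : (n q : ℕ) .{{_ : NonZero q}} → ℕ
t n q = length (Graph.edges (T n q))

-- The common color of the edges inside the partite sets is `nothing`; an edge
-- uv between different parts has as its own color its pair of endpoints.
colorH : (q : ℕ) .{{_ : NonZero q}} → Fin n → Fin n → Maybe (ℕ × ℕ)
colorH q u v with part q u ℕ.≟ part q v
... | yes _ = nothing
... | no  _ = just (toℕ u ⊓ toℕ v , toℕ u ⊔ toℕ v)

colorH-sym : (q : ℕ) .{{_ : NonZero q}} (u v : Fin n) → colorH q u v ≡ colorH q v u
colorH-sym q u v with part q u ℕ.≟ part q v | part q v ℕ.≟ part q u
... | yes _  | yes _  = refl
... | yes p  | no ¬p  = contradiction (sym p) ¬p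
... | no ¬p  | yes p  = contradiction (sym p) ¬p
... | no _   | no _   = cong just (cong₂ _,_ (ℕ.⊓-comm (toℕ u) (toℕ v)) (ℕ.⊔-comm (toℕ u) (toℕ v)))

H : (n q : ℕ) .{{_ : NonZero q}} → EdgeColoredGraph n
H n q = record
  { graph     = K n
  ; Color     = Maybe (ℕ × ℕ)
  ; _≟_       = Maybe.≡-dec (Product.≡-dec ℕ._≟_ ℕ._≟_)
  ; color     = colorH q
  ; color-sym = colorH-sym q
  }

-- A rainbow copy of F in G, not necessarily induced.
record RainbowCopy (F : Graph m) (G : EdgeColoredGraph n) : Set where
  private
    module F = Graph F
    module G = EdgeColoredGraph G
  field
    embed     : Fin m → Fin n
    injective : Injective _≡_ _≡_ embed
    preserves : ∀ {u v} → F.Adj u v → G.Adj (embed u) (embed v)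
    rainbow   : ∀ {u v x y} → F.Adj u v → F.Adj x y →
                G.color (embed u) (embed v) ≡ G.color (embed x) (embed y) →
                (u ≡ x × v ≡ y) ⊎ (u ≡ y × v ≡ x)

-- Isomorphism up to renaming of colors: `rename` need only be injective on
-- the colors that appear in G.
record _≅_ (G G′ : EdgeColoredGraph n) : Set where
  private
    module G  = EdgeColoredGraph G
    module G′ = EdgeColoredGraph G′
  field
    σ          : Permutation′ n
    adj⇔       : ∀ u v → G.Adj u v ⇔ G′.Adj (σ ⟨$⟩ʳ u) (σ ⟨$⟩ʳ v)
    rename     : G.Color → G′.Color
    rename-inj : ∀ {u v x y} → G.Adj u v → G.Adj x y →
                 rename (G.color u v) ≡ rename (G.color x y) →
                 G.color u v ≡ G.color x y
    color-≡    : ∀ {u v} → G.Adj u v →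
                 G′.color (σ ⟨$⟩ʳ u) (σ ⟨$⟩ʳ v) ≡ rename (G.color u v)

Complete : EdgeColoredGraph n → Set
Complete G = ∀ {u v} → u ≢ v → EdgeColoredGraph.Adj G u v

_∈𝓗_ : EdgeColoredGraph n → (k : ℕ) .{{_ : NonZero (k ∸ 2)}} → Set
_∈𝓗_ {n} G k =
    G ≅ H n (k ∸ 2)
  ⊎ ( n / (k ∸ 2) ≡ 1
    × Complete G
    × c[ G ] ≡ t n (k ∸ 2) + 1
    × RainbowCopy (T n (k ∸ 2)) G
    × ¬ RainbowCopy (K k) G )

6≤k⇒k∸2≢0 : ∀ {k} → 6 ≤ k → NonZero (k ∸ 2)
6≤k⇒k∸2≢0 (s≤s (s≤s (s≤s _))) = _

{-# OPTIONS --safe #-}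
-- Put q = k - 2.  By induction on n, every G on n > q vertices without a
-- rainbow K_k and with m(G) + c(G) at least the given value is complete, has
-- t_{n,q} + 1 colors and contains a rainbow T_{n,q}.  By averaging, some vertex
-- v can be deleted at a loss of edges and colors small enough for the induction
-- hypothesis to apply to G - v; comparing the counts, the colors lost with v
-- number at least the vertices of G - v outside a smallest part of T_{n-1,q}.
-- Represent each lost color by one edge at v.  A rainbow transversal together
-- with a twin (the edge between them having a color that does not occur in
-- T_{n-1,q}) becomes a rainbow K_k with v if all its vertices are ends of
-- representing edges.  Hence the representing edges miss a part, possibly after
-- an exchange of two vertices, and v joins that part.  When all parts have at
-- least two vertices and q ≥ 4, all edges inside the parts have the same color: a
-- second color would again allow a rainbow K_k, now with two twins.
module Submission where

open import Defs
import Data.Nat.Properties as ℕ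
open import Algebra.Properties.CommutativeMonoid.Sum ℕ.+-0-commutativeMonoid using (sum; ∑-distrib-+)
open import Data.Bool using (if_then_else_)
import Data.Fin as F
open import Data.Fin using (Fin; zero; suc; toℕ; inject₁; inject≤; fromℕ; fromℕ<; _<?_; punchIn; punchOut)
open import Data.Fin.Permutation using (permutation)
import Data.Fin.Properties as Fin
open import Data.Fin.Relation.Unary.Top using (View; view; ‵fromℕ; ‵inject₁)
open import Data.List using (List; []; _∷_; _++_; length; map; filter; deduplicate; allFin; cartesianProduct; upTo)
import Data.List.Membership.DecPropositional as DecMembership
open import Data.List.Membership.Propositional using (_∈_; _∉_; find)
open import Data.List.Membership.Propositional.Properties
  using (∈-∃++; ∈-++⁺ˡ; ∈-++⁺ʳ; ∈-++⁻; ∈-filter⁺; ∈-filter⁻; ∈-cartesianProduct⁺; ∈-allFin; ∈-map⁺; ∈-map⁻;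
         ∈-deduplicate⁺; ∈-deduplicate⁻; ∈-length; ∈-upTo⁺; ∈-upTo⁻)
open import Data.List.Properties using (length-++; length-map; length-upTo; length-tabulate)
open import Data.List.Relation.Unary.All as All using (All; []; _∷_)
open import Data.List.Relation.Unary.All.Properties using (¬All⇒Any¬)
open import Data.List.Relation.Unary.AllPairs using ([]; _∷_)
open import Data.List.Relation.Unary.Any using (here; there)
open import Data.List.Relation.Unary.Unique.Propositional using (Unique)
import Data.List.Relation.Unary.Unique.DecPropositional.Properties as UniqueDec
import Data.List.Relation.Unary.Unique.Propositional.Properties as Unique
open import Data.Maybe using (Maybe; just; nothing)
import Data.Maybe.Properties as Maybe
open import Data.Maybe.Properties using (just-injective)
open import Data.Nat using (ℕ; zero; suc; pred; _+_; _*_; _∸_; _≤_; _<_; z≤n; s≤s; NonZero; _≤?_)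
open import Data.Nat.Combinatorics using (_C_; nCk+nC[k+1]≡[n+1]C[k+1]; nC1≡n)
open import Data.Nat.Divisibility using (n∣m*n)
open import Data.Nat.DivMod
open import Data.Nat.Tactic.RingSolver using (solve-∀)
open import Data.Product using (_×_; _,_; proj₁; proj₂; uncurry; ∃; ∃₂)
import Data.Product.Properties as Product
open import Data.Product.Properties using (,-injective)
open import Data.Sum as Sum using (_⊎_; inj₁; inj₂)
open import Data.Vec.Functional using () renaming (_∷_ to _◂_)
open import Function using (_∘_; id; case_of_; mk⇔; Injective)
open import Level using (0ℓ)
open import Relation.Binary using (Tri; tri<; tri≈; tri>)
open import Relation.Binary.PropositionalEquality hiding ([_])
open import Relation.Nullary using (¬_; Dec; yes; no; does; contradiction; ¬?; _×-dec_; _⊎-dec_)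
open import Relation.Nullary.Decidable using (decidable-stable)
open import Relation.Unary using (Pred; Decidable)

-- The induction assumes only a lower bound on m(G) + c(G), because averaging bounds the loss from
-- above and G - v may lie beyond the threshold. For N = r + a q at least q, with r < q, the
-- averaging inequality amounts to (r + 1)(a + 1) being at least 3, which fails only for N = q;
-- hence the start at q + 1 vertices, where G has to be complete and rainbow. The color count leaves
-- room for one color outside T_{n,q}, but edges inside the parts may also repeat colors of T_{n,q},
-- and a repeated color blocks the cliques that contain the cross edge carrying it. If all parts
-- have two vertices, a transversal can avoid an end of that edge. For n < 2q some part is a
-- singleton and this freedom is lost, so the parts need not be monochromatic: this is the source of
-- type (II) and of the separate argument for that range. The bound q ≥ 4 enters through a
-- pigeonhole. Let zz′ be an edge inside a part with the new color. An inside edge of another part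
-- that repeats the color of a cross edge forces this cross edge to end in z or z′, and different
-- parts use different ends. So of three further parts at least one has a pair that repeats no color
-- of T_{n,q}.

private
  variable
    A B : Set
    m n s : ℕ

-- Counting by duplicate-free lists

length-⊆ : {xs ys : List A} → Unique xs → (∀ {x} → x ∈ xs → x ∈ ys) → length xs ≤ length ys
length-⊆ {xs = []} _ _ = z≤n
length-⊆ {xs = x ∷ xs} (x∉ ∷ u) ⊆ys with ∈-∃++ (⊆ys (here refl))
... | as , bs , refl = subst (suc (length xs) ≤_) (sym len) (s≤s (length-⊆ u sub))
  where
  len : length (as ++ x ∷ bs) ≡ suc (length (as ++ bs))
  len = trans (length-++ as) (trans (ℕ.+-suc _ _) (cong suc (sym (length-++ as))))
  sub : ∀ {y} → y ∈ xs → y ∈ as ++ bs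
  sub {y} y∈ with ∈-++⁻ as (⊆ys (there y∈))
  ... | inj₁ p = ∈-++⁺ˡ p
  ... | inj₂ (here refl) = contradiction refl (All.lookup x∉ y∈)
  ... | inj₂ (there p) = ∈-++⁺ʳ as p

unique-map : {f : A → B} {xs : List A} → Unique xs →
             (∀ {x y} → x ∈ xs → y ∈ xs → f x ≡ f y → x ≡ y) → Unique (map f xs)
unique-map [] _ = []
unique-map {f = f} {xs = x ∷ xs} (x∉ ∷ u) inj =
  All.tabulate (λ z∈ eq → let (y , y∈ , z≡) = ∈-map⁻ f z∈ in
    All.lookup x∉ y∈ (inj (here refl) (there y∈) (trans eq z≡)))
  ∷ unique-map u (λ p q → inj (there p) (there q))

length-filter-∁ : {P : Pred A 0ℓ} (P? : Decidable P) (xs : List A) →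
                  length (filter P? xs) + length (filter (¬? ∘ P?) xs) ≡ length xs
length-filter-∁ P? [] = refl
length-filter-∁ P? (x ∷ xs) with P? x
... | yes _ = cong suc (length-filter-∁ P? xs)
... | no _ = trans (ℕ.+-suc _ _) (cong suc (length-filter-∁ P? xs))

# : {P : Pred (Fin n) 0ℓ} → Decidable P → ℕ
# P? = length (filter P? (allFin _))

length-allFin : ∀ n → length (allFin n) ≡ n
length-allFin n = length-tabulate id

#-unique : {P : Pred (Fin n) 0ℓ} (P? : Decidable P) → Unique (filter P? (allFin n))
#-unique P? = Unique.filter⁺ P? (Unique.allFin⁺ _)

∈#⁺ : {P : Pred (Fin n) 0ℓ} (P? : Decidable P) → ∀ {i} → P i → i ∈ filter P? (allFin n)
∈#⁺ P? p = ∈-filter⁺ P? (∈-allFin _) p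

∈#⁻ : {P : Pred (Fin n) 0ℓ} (P? : Decidable P) → ∀ {i} → i ∈ filter P? (allFin n) → P i
∈#⁻ P? i∈ = proj₂ (∈-filter⁻ P? {xs = allFin _} i∈)

#≤n : {P : Pred (Fin n) 0ℓ} (P? : Decidable P) → # P? ≤ n
#≤n {n} P? = subst (# P? ≤_) (length-allFin n) (length-⊆ (#-unique P?) (λ _ → ∈-allFin _))

#≥n⇒∀ : {P : Pred (Fin n) 0ℓ} (P? : Decidable P) → n ≤ # P? → ∀ i → P i
#≥n⇒∀ {n} P? n≤ i with P? i
... | yes p = p
... | no ¬p = contradiction n≤ (ℕ.<⇒≱ (subst (suc (# P?) ≤_) (length-allFin n)
  (length-⊆ (All.tabulate (λ { j∈ refl → ¬p (∈#⁻ P? j∈) }) ∷ #-unique P?) (λ _ → ∈-allFin _))))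

∀⇒#≥n : {P : Pred (Fin n) 0ℓ} (P? : Decidable P) → (∀ i → P i) → n ≤ # P?
∀⇒#≥n {n} P? p = subst (_≤ # P?) (length-allFin n)
  (length-⊆ (Unique.allFin⁺ n) (λ {i} _ → ∈#⁺ P? (p i)))

module _ {P Q : Pred (Fin n) 0ℓ} (P? : Decidable P) (Q? : Decidable Q)
         (disj : ∀ {i} → P i → ¬ Q i) where

  private
    both : Unique (filter P? (allFin n) ++ filter Q? (allFin n))
    both = Unique.++⁺ (#-unique P?) (#-unique Q?) (λ (p , q) → disj (∈#⁻ P? p) (∈#⁻ Q? q))

  #-disjoint : # P? + # Q? ≤ n
  #-disjoint = subst₂ _≤_ (length-++ (filter P? (allFin n))) (length-allFin n)
    (length-⊆ both (λ _ → ∈-allFin _))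

  #-cover : n ≤ # P? + # Q? → ∀ {i} → ¬ Q i → P i
  #-cover n≤ {i} ¬q with P? i
  ... | yes p = p
  -- An element outside both sets, put in front of the two disjoint lists, would give a
  -- duplicate-free list of more than `n` elements.
  ... | no ¬p = contradiction n≤ (ℕ.<⇒≱ (subst₂ (λ a b → suc a ≤ b)
      (length-++ (filter P? (allFin n))) (length-allFin n)
      (length-⊆ (All.tabulate fresh ∷ both) (λ _ → ∈-allFin _))))
    where
    fresh : ∀ {j} → j ∈ filter P? (allFin n) ++ filter Q? (allFin n) → i ≢ j
    fresh j∈ refl with ∈-++⁻ (filter P? (allFin n)) j∈
    ... | inj₁ x = ¬p (∈#⁻ P? x)
    ... | inj₂ x = ¬q (∈#⁻ Q? x)

#-∁ : {P Q : Pred (Fin n) 0ℓ} (P? : Decidable P) (Q? : Decidable Q) →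
      (∀ {i} → P i → ¬ Q i) → (∀ {i} → ¬ Q i → P i) → # P? + # Q? ≡ n
#-∁ {n} P? Q? disj cover = ℕ.≤-antisym (#-disjoint P? Q? disj)
  (subst₂ _≤_ (length-allFin n) (length-++ (filter P? (allFin n)))
    (length-⊆ (Unique.allFin⁺ n) all∈))
  where
  all∈ : ∀ {i} → i ∈ allFin n → i ∈ filter P? (allFin n) ++ filter Q? (allFin n)
  all∈ {i} _ with Q? i
  ... | yes q = ∈-++⁺ʳ _ (∈#⁺ Q? q)
  ... | no ¬q = ∈-++⁺ˡ (∈#⁺ P? (cover ¬q))

injective⇒surjective : {f : Fin n → Fin n} → Injective _≡_ _≡_ f → ∀ j → ∃ λ i → f i ≡ j
injective⇒surjective {zero} _ ()
injective⇒surjective {suc n} {f} inj j with Fin.any? (λ i → f i Fin.≟ j)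
... | yes p = p
... | no ∄ = contradiction
  (Fin.injective⇒≤ {f = λ i → punchOut {i = j} {j = f i} (λ e → ∄ (i , sym e))}
    (λ {x} {y} e → inj (Fin.punchOut-injective {i = j} {j = f x} {k = f y} _ _ e)))
  (ℕ.<⇒≱ (ℕ.n<1+n n))

-- Edge lists and binomial coefficients

module _ (F : Graph n) where
  open Graph F

  private
    edge? : (p : Fin n × Fin n) → Dec (proj₁ p F.< proj₂ p × uncurry Adj p)
    edge? (u , v) = (u <? v) ×-dec adj? u v

  ∈edges⁺ : ∀ {u v} → u F.< v → Adj u v → (u , v) ∈ edges
  ∈edges⁺ {u} {v} u<v uv =
    ∈-filter⁺ edge? (∈-cartesianProduct⁺ (∈-allFin u) (∈-allFin v)) (u<v , uv)

  ∈edges⁻ : ∀ {u v} → (u , v) ∈ edges → u F.< v × Adj u v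
  ∈edges⁻ e∈ = proj₂ (∈-filter⁻ edge? {xs = cartesianProduct (allFin n) (allFin n)} e∈)

  edges-unique : Unique edges
  edges-unique = Unique.filter⁺ edge? (Unique.cartesianProduct⁺ (Unique.allFin⁺ n) (Unique.allFin⁺ n))

  Adj⇒≢ : ∀ {u v} → Adj u v → u ≢ v
  Adj⇒≢ uv refl = adj-irrefl uv

module _ (F : Graph (suc n)) (F′ : Graph n)
         (⇒′ : ∀ {i j} → Graph.Adj F (inject₁ i) (inject₁ j) → Graph.Adj F′ i j)
         (⇐′ : ∀ {i j} → Graph.Adj F′ i j → Graph.Adj F (inject₁ i) (inject₁ j)) where
  private
    module E = Graph F
    module E′ = Graph F′
    nbr? : Decidable (λ i → E.Adj (inject₁ i) (fromℕ n))
    nbr? i = E.adj? (inject₁ i) (fromℕ n)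
    old : Fin n × Fin n → Fin (suc n) × Fin (suc n)
    old (i , j) = inject₁ i , inject₁ j
    new : Fin n → Fin (suc n) × Fin (suc n)
    new i = inject₁ i , fromℕ n
    all : List (Fin (suc n) × Fin (suc n))
    all = map old E′.edges ++ map new (filter nbr? (allFin n))

    all-length : length all ≡ length E′.edges + # nbr?
    all-length = trans (length-++ (map old E′.edges))
      (cong₂ _+_ (length-map old E′.edges) (length-map new (filter nbr? (allFin n))))

    inject₁-< : ∀ {i j : Fin n} → inject₁ i F.< inject₁ j → i F.< j
    inject₁-< {i} {j} = subst₂ _<_ (Fin.toℕ-inject₁ i) (Fin.toℕ-inject₁ j)

    ⊆all : ∀ {e} → e ∈ E.edges → e ∈ all
    ⊆all {u , v} e∈ with view u | view v | ∈edges⁻ F e∈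
    ... | ‵fromℕ | v′ | u<v , _ = contradiction u<v (ℕ.≤⇒≯ (Fin.≤fromℕ v))
    ... | ‵inject₁ i | ‵fromℕ | u<v , uv = ∈-++⁺ʳ _ (∈-map⁺ new (∈#⁺ nbr? uv))
    ... | ‵inject₁ i | ‵inject₁ j | u<v , uv =
      ∈-++⁺ˡ (∈-map⁺ old (∈edges⁺ F′ (inject₁-< u<v) (⇒′ uv)))

    all⊆ : ∀ {e} → e ∈ all → e ∈ E.edges
    all⊆ e∈ with ∈-++⁻ (map old E′.edges) e∈
    ... | inj₁ p with (i , j) , q , refl ← ∈-map⁻ old p =
      let i<j , ij = ∈edges⁻ F′ q in
      ∈edges⁺ F (subst₂ _<_ (sym (Fin.toℕ-inject₁ i)) (sym (Fin.toℕ-inject₁ j)) i<j) (⇐′ ij)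
    ... | inj₂ p with i , q , refl ← ∈-map⁻ new p =
      ∈edges⁺ F (subst₂ _<_ (sym (Fin.toℕ-inject₁ i)) (sym (Fin.toℕ-fromℕ n)) (Fin.toℕ<n i)) (∈#⁻ nbr? q)

    all-unique : Unique all
    all-unique = Unique.++⁺
      (Unique.map⁺ (λ e → let a , b = ,-injective e in cong₂ _,_ (Fin.inject₁-injective a) (Fin.inject₁-injective b)) (edges-unique F′))
      (Unique.map⁺ (λ e → Fin.inject₁-injective (proj₁ (,-injective e))) (#-unique nbr?))
      λ (p , q) → let (_ , _ , a) = ∈-map⁻ old p
                      (_ , _ , b) = ∈-map⁻ new q
                  in Fin.fromℕ≢inject₁ (proj₂ (,-injective (trans (sym b) a)))

  -- `F′` is `F` without its last vertex. That vertex is the largest, so in `edges` it occurs only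
  -- as a second endpoint. Removing the last vertex also leaves all residues alone, so that one
  -- lemma serves both `K` and `T`.
  length-edges-suc : length E.edges ≡ length E′.edges + # nbr?
  length-edges-suc = trans
    (ℕ.≤-antisym (length-⊆ (edges-unique F) ⊆all) (length-⊆ all-unique all⊆)) all-length

edges-K : ∀ n → length (Graph.edges (K n)) ≡ n C 2
edges-K zero = refl
edges-K (suc n) = trans
  (length-edges-suc (K (suc n)) (K n) (_∘ cong inject₁) (_∘ Fin.inject₁-injective))
  (trans (cong₂ _+_ (edges-K n) all)
  (trans (ℕ.+-comm (n C 2) n)
  (trans (cong (_+ n C 2) (sym (nC1≡n n))) (nCk+nC[k+1]≡[n+1]C[k+1] n 1))))
  where
  last? : Decidable (λ (i : Fin n) → inject₁ i ≢ fromℕ n)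
  last? i = Graph.adj? (K (suc n)) (inject₁ i) (fromℕ n)
  all : # last? ≡ n
  all = ℕ.≤-antisym (#≤n last?) (∀⇒#≥n last? (λ _ → Fin.fromℕ≢inject₁ ∘ sym))

C2-suc : ∀ n → suc n C 2 ≡ n C 2 + n
C2-suc n = trans (sym (nCk+nC[k+1]≡[n+1]C[k+1] n 1)) (trans (cong (_+ n C 2) (nC1≡n n)) (ℕ.+-comm n (n C 2)))

2C2 : ∀ n → 2 * (n C 2) + n ≡ n * n
2C2 zero = refl
2C2 (suc n) rewrite C2-suc n = trans (lemma (n C 2) n) (trans (cong (_+ (n + suc n)) (2C2 n)) (lemma₂ n))
  where
  lemma : ∀ c n → 2 * (c + n) + suc n ≡ 2 * c + n + (n + suc n)
  lemma = solve-∀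
  lemma₂ : ∀ n → n * n + (n + suc n) ≡ suc n * suc n
  lemma₂ = solve-∀

-- Turán numbers

module _ (q : ℕ) .{{_ : NonZero q}} where

  [r+bq]%q : ∀ {r} b → r < q → (r + b * q) % q ≡ r
  [r+bq]%q {r} b r<q = trans ([m+kn]%n≡m%n r b q) (m<n⇒m%n≡m r<q)

  [r+bq]/q : ∀ {r} b → r < q → (r + b * q) / q ≡ b
  [r+bq]/q {r} b r<q = trans (+-distrib-/-∣ʳ r (n∣m*n b)) (cong₂ _+_ (m<n⇒m/n≡0 r<q) (m*n/n≡m b q))

  r+bq<n : ∀ {n r b} → r < q → b < n / q → r + b * q < n
  r+bq<n {n} {r} {b} r<q b<a = ℕ.≤-trans (ℕ.+-monoˡ-< (b * q) r<q)
    (ℕ.≤-trans (ℕ.*-monoˡ-≤ q b<a) (m/n*n≤m n q))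

  r+bq<n′ : ∀ {n r b} → r < n % q → b ≤ n / q → r + b * q < n
  r+bq<n′ {n} {r} {b} r<s b≤a = subst (r + b * q <_) (sym (m≡m%n+[m/n]*n n q))
    (ℕ.+-mono-<-≤ r<s (ℕ.*-monoˡ-≤ q b≤a))

  /-<-/ : ∀ {n i} → i < n → n % q ≤ i % q → i / q < n / q
  /-<-/ {n} {i} i<n s≤r = ℕ.≰⇒> λ a≤b → ℕ.<⇒≱ i<n
    (subst₂ _≤_ (sym (m≡m%n+[m/n]*n n q)) (sym (m≡m%n+[m/n]*n i q))
      (ℕ.+-mono-≤ s≤r (ℕ.*-monoˡ-≤ q a≤b)))

  part-injective : {u v : Fin n} → part q u ≡ part q v → toℕ u / q ≡ toℕ v / q → u ≡ v
  part-injective {u = u} {v} p e = Fin.toℕ-injective (trans (m≡m%n+[m/n]*n (toℕ u) q)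
    (trans (cong₂ (λ x y → x + y * q) p e) (sym (m≡m%n+[m/n]*n (toℕ v) q))))

  class? : ∀ r → Decidable (λ (i : Fin n) → part q i ≡ r)
  class? r i = part q i ℕ.≟ r

  private
    level : Fin n → ℕ
    level i = toℕ i / q

    -- Each level `b < l` contributes the vertex `r + b * q`, and division by `q` recovers the
    -- level.
    class-≥ : ∀ r l → r < q → (∀ {b} → b < l → r + b * q < n) → l ≤ # (class? {n} r)
    class-≥ {n} r l r<q below = subst₂ _≤_ (length-upTo l) (length-map level (filter (class? r) (allFin n)))
      (length-⊆ (Unique.upTo⁺ l) λ {b} b∈ →
        let b<l = ∈-upTo⁻ b∈
            i = fromℕ< (below b<l)
            eq = Fin.toℕ-fromℕ< (below b<l)
        in subst (_∈ map level (filter (class? r) (allFin n))) (trans (cong (_/ q) eq) ([r+bq]/q b r<q))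
             (∈-map⁺ level (∈#⁺ (class? r) {i} (trans (cong (_% q) eq) ([r+bq]%q b r<q)))))

  n/q≤#class : ∀ {r} → r < q → n / q ≤ # (class? {n} r)
  n/q≤#class {r = r} r<q = class-≥ r _ r<q (r+bq<n r<q)

  n/q<#class : ∀ {r} → r < n % q → suc (n / q) ≤ # (class? {n} r)
  n/q<#class {n} {r} r<s = class-≥ r _ (ℕ.<-trans r<s (m%n<n n q)) (λ b<l → r+bq<n′ r<s (ℕ.≤-pred b<l))

  #class≤n/q : ∀ {r} → n % q ≤ r → # (class? {n} r) ≤ n / q
  #class≤n/q {n} {r} s≤r = subst₂ _≤_ (length-map level (filter (class? r) (allFin n))) (length-upTo (n / q))
    (length-⊆ (unique-map (#-unique (class? r)) λ i∈ j∈ →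
                part-injective (trans (∈#⁻ (class? r) i∈) (sym (∈#⁻ (class? r) j∈))))
      λ x∈ → let (i , i∈ , x≡) = ∈-map⁻ level x∈ in
        subst (_∈ upTo (n / q)) (sym x≡)
          (∈-upTo⁺ (/-<-/ (Fin.toℕ<n i) (subst (n % q ≤_) (sym (∈#⁻ (class? r) i∈)) s≤r))))

  -- The last vertex has residue `n % q`, a class with exactly `n / q` elements below `n`, and is
  -- adjacent to everything else. The additive form avoids truncated subtraction.
  t-suc : ∀ n → t (suc n) q + n / q ≡ t n q + n
  t-suc n = trans (cong (_+ n / q) (length-edges-suc (T (suc n) q) (T n q)
      (λ {i} {j} → subst₂ _≢_ (part-inject₁ i) (part-inject₁ j))
      (λ {i} {j} → subst₂ _≢_ (sym (part-inject₁ i)) (sym (part-inject₁ j)))))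
    (trans (ℕ.+-assoc (t n q) _ _) (cong (t n q +_) (trans (cong (# nbr? +_) (sym size))
      (#-∁ nbr? (class? (n % q)) (λ {i} i≁last e → i≁last (trans (part-inject₁ i) (trans e (sym last))))
        (λ {i} i≁last e → i≁last (trans (sym (part-inject₁ i)) (trans e last)))))))
    where
    part-inject₁ : ∀ i → part q (inject₁ i) ≡ part q i
    part-inject₁ i = cong (_% q) (Fin.toℕ-inject₁ i)
    last : part q (fromℕ n) ≡ n % q
    last = cong (_% q) (Fin.toℕ-fromℕ n)
    nbr? : Decidable (λ (i : Fin n) → part q (inject₁ i) ≢ part q (fromℕ n))
    nbr? i = Graph.adj? (T (suc n) q) (inject₁ i) (fromℕ n)
    size : # (class? {n} (n % q)) ≡ n / q
    size = ℕ.≤-antisym (#class≤n/q ℕ.≤-refl) (n/q≤#class (m%n<n n q))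

  -- The degree sum of T_{n,q} for n = r + a q: r (a + 1) vertices have degree
  -- n - a - 1 and the others n - a.
  t-closed : ∀ a r → r ≤ q →
    2 * t (r + a * q) q + ((r + a * q) * a + r * suc a) ≡ (r + a * q) * (r + a * q)
  t-closed zero zero _ = refl
  -- Admitting `r = q` links the levels: `0 + suc a * q` and `q + a * q` are definitionally equal,
  -- so the end of one level is the start of the next.
  t-closed (suc a) zero _ =
    trans (cong (2 * t (q + a * q) q +_) (lemma q a)) (t-closed a q ℕ.≤-refl)
    where
    lemma : ∀ q a → (q + a * q) * suc a + 0 ≡ (q + a * q) * a + q * suc a
    lemma = solve-∀
  t-closed a (suc r) r<q = ℕ.+-cancelʳ-≡ (2 * a) _ _
    (trans (lemma (t (suc N) q) N r a)
    (trans (cong (λ x → 2 * x + (N * a + r * suc a + suc (2 * a))) suc-t)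
    (trans (lemma₂ (t N q) N r a)
    (trans (cong (_+ (2 * N + suc (2 * a))) (t-closed a r (ℕ.<⇒≤ r<q)))
    (lemma₃ N a)))))
    where
    N = r + a * q
    suc-t : t (suc N) q + a ≡ t N q + N
    suc-t = subst (λ x → t (suc N) q + x ≡ t N q + N) ([r+bq]/q a r<q) (t-suc N)
    lemma : ∀ t n r a → 2 * t + (suc n * a + suc r * suc a) + 2 * a
                      ≡ 2 * (t + a) + (n * a + r * suc a + suc (2 * a))
    lemma = solve-∀
    lemma₂ : ∀ t n r a → 2 * (t + n) + (n * a + r * suc a + suc (2 * a))
                       ≡ 2 * t + (n * a + r * suc a) + (2 * n + suc (2 * a))
    lemma₂ = solve-∀
    lemma₃ : ∀ n a → n * n + (2 * n + suc (2 * a)) ≡ suc n * suc n + 2 * a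
    lemma₃ = solve-∀

-- Sums and double counting

∑ : (Fin n → ℕ) → ℕ
∑ = sum

∑-mono : {f g : Fin n → ℕ} → (∀ i → f i ≤ g i) → ∑ f ≤ ∑ g
∑-mono {zero} _ = z≤n
∑-mono {suc n} f≤g = ℕ.+-mono-≤ (f≤g zero) (∑-mono (f≤g ∘ suc))

∑-const : ∀ n x → ∑ {n} (λ _ → x) ≡ n * x
∑-const zero x = refl
∑-const (suc n) x = cong (x +_) (∑-const n x)

[_] : Dec A → ℕ
[ d ] = if does d then 1 else 0

∑-[≟] : (a : Fin n) → ∑ (λ v → [ v Fin.≟ a ]) ≡ 1
∑-[≟] {suc n} zero = cong suc (trans (∑-const n 0) (ℕ.*-zeroʳ n))
∑-[≟] {suc n} (suc a) = ∑-[≟] a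

∑-count≤2 : {P : Fin n → Set} (P? : ∀ v → Dec (P v)) {a b : Fin n} →
            (∀ v → P v → v ≡ a ⊎ v ≡ b) → ∑ (λ v → [ P? v ]) ≤ 2
∑-count≤2 P? {a} {b} ab = ℕ.≤-trans (∑-mono bound)
  (ℕ.≤-reflexive (trans (∑-distrib-+ (λ v → [ v Fin.≟ a ]) (λ v → [ v Fin.≟ b ])) (cong₂ _+_ (∑-[≟] a) (∑-[≟] b))))
  where
  bound : ∀ v → [ P? v ] ≤ [ v Fin.≟ a ] + [ v Fin.≟ b ]
  bound v with P? v | v Fin.≟ a | v Fin.≟ b
  ... | no _ | _ | _ = z≤n
  ... | yes _ | yes _ | _ = s≤s z≤n
  ... | yes _ | no _ | yes _ = s≤s z≤n
  ... | yes p | no ≢a | no ≢b with ab v p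
  ...   | inj₁ e = contradiction e ≢a
  ...   | inj₂ e = contradiction e ≢b

-- Double counting: the sum is taken over `xs` first, and each element is counted by at most two of
-- the `v`.
∑-filter≤ : {P : Fin n → A → Set} (P? : ∀ v → Decidable (P v)) (xs : List A) →
            (∀ {x} → x ∈ xs → ∃₂ λ a b → ∀ v → P v x → v ≡ a ⊎ v ≡ b) →
            ∑ (λ v → length (filter (P? v) xs)) ≤ length xs * 2
∑-filter≤ {n} P? [] _ = ℕ.≤-reflexive (trans (∑-const n 0) (ℕ.*-zeroʳ n))
∑-filter≤ P? (x ∷ xs) ends = ℕ.≤-trans (∑-mono step)
  (ℕ.≤-trans (ℕ.≤-reflexive (∑-distrib-+ (λ v → [ P? v x ]) (λ v → length (filter (P? v) xs))))
    (ℕ.+-mono-≤ (∑-count≤2 (λ v → P? v x) (proj₂ (proj₂ (ends (here refl)))))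
                (∑-filter≤ P? xs (ends ∘ there))))
  where
  step : ∀ v → length (filter (P? v) (x ∷ xs)) ≤ [ P? v x ] + length (filter (P? v) xs)
  step v with P? v x
  ... | yes _ = ℕ.≤-refl
  ... | no _ = ℕ.≤-refl

-- Vertex deletion

pullback : (Fin m → Fin n) → EdgeColoredGraph n → EdgeColoredGraph m
pullback ι G = record
  { graph = record
    { Adj = λ u v → Adj (ι u) (ι v)
    ; adj? = λ u v → adj? (ι u) (ι v)
    ; adj-sym = adj-sym
    ; adj-irrefl = adj-irrefl
    }
  ; Color = Color
  ; _≟_ = _≟_
  ; color = λ u v → color (ι u) (ι v)
  ; color-sym = λ u v → color-sym (ι u) (ι v)
  }
  where open EdgeColoredGraph G

del : Fin (suc n) → EdgeColoredGraph (suc n) → EdgeColoredGraph n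
del v = pullback (punchIn v)

module _ (G : EdgeColoredGraph n) where
  open EdgeColoredGraph G hiding (m[_]; c[_])

  colors : List Color
  colors = deduplicate _≟_ (map (uncurry color) edges)

  colors-unique : Unique colors
  colors-unique = UniqueDec.deduplicate-! _≟_ _

  ∈colors⁺ : ∀ {u v} → Adj u v → color u v ∈ colors
  ∈colors⁺ {u} {v} uv with Fin.<-cmp u v
  ... | tri< u<v _ _ = ∈-deduplicate⁺ _≟_ (∈-map⁺ (uncurry color) (∈edges⁺ graph u<v uv))
  ... | tri≈ _ refl _ = contradiction uv adj-irrefl
  ... | tri> _ _ v<u = subst (_∈ colors) (color-sym v u)
    (∈-deduplicate⁺ _≟_ (∈-map⁺ (uncurry color) (∈edges⁺ graph v<u (adj-sym uv))))

  ∈colors⁻ : ∀ {γ} → γ ∈ colors → ∃₂ λ u v → u F.< v × Adj u v × γ ≡ color u v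
  ∈colors⁻ γ∈ with (u , v) , e∈ , eq ← ∈-map⁻ (uncurry color) (∈-deduplicate⁻ _≟_ _ γ∈) =
    let u<v , uv = ∈edges⁻ graph e∈ in u , v , u<v , uv , eq

  edges⊆K : ∀ {e} → e ∈ edges → e ∈ Graph.edges (K n)
  edges⊆K {u , v} e∈ = let u<v , uv = ∈edges⁻ graph e∈ in ∈edges⁺ (K n) u<v (Adj⇒≢ graph uv)

  m≤C2 : m[ G ] ≤ n C 2
  m≤C2 = subst (m[ G ] ≤_) (edges-K n) (length-⊆ (edges-unique graph) edges⊆K)

  complete : n C 2 ≤ m[ G ] → Complete G
  complete C2≤m {u} {v} u≢v = either (Fin.<-cmp u v)
    where
    ordered : ∀ {u v} → u F.< v → Adj u v
    ordered {u} {v} u<v with adj? u v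
    ... | yes uv = uv
    ... | no ¬uv = contradiction C2≤m (ℕ.<⇒≱ (subst (m[ G ] <_) (edges-K n)
      (length-⊆ (All.tabulate (λ { e∈ refl → ¬uv (proj₂ (∈edges⁻ graph e∈)) }) ∷ edges-unique graph)
        λ { (here refl) → ∈edges⁺ (K n) u<v (Fin.<⇒≢ u<v) ; (there e∈) → edges⊆K e∈ })))
    either : Tri (u F.< v) (u ≡ v) (v F.< u) → Adj u v
    either (tri< u<v _ _) = ordered u<v
    either (tri≈ _ u≡v _) = contradiction u≡v u≢v
    either (tri> _ _ v<u) = adj-sym (ordered v<u)

  c≤m : c[ G ] ≤ m[ G ]
  c≤m = subst (c[ G ] ≤_) (length-map (uncurry color) edges)
    (length-⊆ colors-unique (∈-deduplicate⁻ _≟_ _))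

  -- If `e` shared its color with another edge `f`, the edges other than `e` would already show
  -- every color, and there would be fewer colors than edges.
  m≤c⇒injective : m[ G ] ≤ c[ G ] → ∀ {e f} → e ∈ edges → f ∈ edges →
                  uncurry color e ≡ uncurry color f → e ≡ f
  m≤c⇒injective m≤c {e} {f} e∈ f∈ eq with Product.≡-dec Fin._≟_ Fin._≟_ e f
  ... | yes e≡f = e≡f
  ... | no e≢f = contradiction m≤c (ℕ.<⇒≱ (ℕ.≤-<-trans
      (subst (c[ G ] ≤_) (length-map (uncurry color) others) (length-⊆ colors-unique others-suffice))
      (length-⊆ (All.tabulate (λ { x∈ refl → proj₂ (∈-filter⁻ ≢e? {xs = edges} x∈) refl })
                   ∷ Unique.filter⁺ ≢e? (edges-unique graph))
        λ { (here refl) → e∈ ; (there x∈) → proj₁ (∈-filter⁻ ≢e? x∈) })))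
    where
    ≢e? : Decidable (_≢ e)
    ≢e? x = ¬? (Product.≡-dec Fin._≟_ Fin._≟_ x e)
    others = filter ≢e? edges
    others-suffice : ∀ {γ} → γ ∈ colors → γ ∈ map (uncurry color) others
    others-suffice γ∈ with ∈-map⁻ (uncurry color) (∈-deduplicate⁻ _≟_ _ γ∈)
    ... | x , x∈ , γ≡ with Product.≡-dec Fin._≟_ Fin._≟_ x e
    ...   | yes refl = subst (_∈ _) (sym (trans γ≡ eq)) (∈-map⁺ (uncurry color) (∈-filter⁺ ≢e? f∈ (e≢f ∘ sym)))
    ...   | no x≢e = subst (_∈ _) (sym γ≡) (∈-map⁺ (uncurry color) (∈-filter⁺ ≢e? x∈ x≢e))

punchIn-surjective : {v u : Fin (suc n)} → u ≢ v → ∃ λ i → punchIn v i ≡ u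
punchIn-surjective u≢v = punchOut (u≢v ∘ sym) , Fin.punchIn-punchOut (u≢v ∘ sym)

module _ (G : EdgeColoredGraph (suc n)) where
  open EdgeColoredGraph G hiding (m[_]; c[_])

  Incident : Fin (suc n) → Fin (suc n) × Fin (suc n) → Set
  Incident v (u , w) = v ≡ u ⊎ v ≡ w

  incident? : ∀ v → Decidable (Incident v)
  incident? v (u , w) = (v Fin.≟ u) ⊎-dec (v Fin.≟ w)

  lostEdges lostColors : Fin (suc n) → ℕ
  lostEdges v = length (filter (incident? v) edges)
  lostColors v = length (filter (_∉? colors (del v G)) (colors G))
    where open DecMembership _≟_ using (_∉?_)

  m≤m-del : ∀ v → m[ G ] ≤ m[ del v G ] + lostEdges v
  m≤m-del v = subst₂ _≤_ (length-filter-∁ (incident? v) edges) (ℕ.+-comm (lostEdges v) _)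
    (ℕ.+-monoʳ-≤ (lostEdges v) (subst (length (filter (¬? ∘ incident? v) edges) ≤_) (length-map lift (EdgeColoredGraph.edges (del v G)))
      (length-⊆ (Unique.filter⁺ (¬? ∘ incident? v) (edges-unique graph)) kept)))
    where
    lift : Fin n × Fin n → Fin (suc n) × Fin (suc n)
    lift (i , j) = punchIn v i , punchIn v j
    kept : ∀ {e} → e ∈ filter (¬? ∘ incident? v) edges → e ∈ map lift (EdgeColoredGraph.edges (del v G))
    kept {u , w} e∈ with ∈-filter⁻ (¬? ∘ incident? v) {xs = edges} e∈
    ... | e∈G , ¬inc
      with i , refl ← punchIn-surjective {v = v} {u} (¬inc ∘ inj₁ ∘ sym)
         | j , refl ← punchIn-surjective {v = v} {w} (¬inc ∘ inj₂ ∘ sym)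
         | u<w , uw ← ∈edges⁻ graph e∈G =
      ∈-map⁺ lift (∈edges⁺ (EdgeColoredGraph.graph (del v G))
        (ℕ.≰⇒> (λ j≤i → ℕ.<⇒≱ u<w (Fin.punchIn-mono-≤ v j i j≤i))) uw)

  c≤c-del : ∀ v → c[ G ] ≤ c[ del v G ] + lostColors v
  c≤c-del v = subst₂ _≤_ (length-filter-∁ (_∉? L) (colors G)) (ℕ.+-comm (lostColors v) _)
    (ℕ.+-monoʳ-≤ (lostColors v) (length-⊆ (Unique.filter⁺ (¬? ∘ (_∉? L)) (colors-unique G)) λ γ∈ →
      decidable-stable (_ ∈? L) (proj₂ (∈-filter⁻ (¬? ∘ (_∉? L)) {xs = colors G} γ∈))))
    where
    open DecMembership _≟_ using (_∈?_; _∉?_)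
    L = colors (del v G)

  lost-color-incident : ∀ {v u w} → Adj u w → color u w ∉ colors (del v G) → v ≡ u ⊎ v ≡ w
  lost-color-incident {v} {u} {w} uw lost with v Fin.≟ u | v Fin.≟ w
  ... | yes e | _ = inj₁ e
  ... | no _ | yes e = inj₂ e
  ... | no v≢u | no v≢w
    with i , refl ← punchIn-surjective (v≢u ∘ sym) | j , refl ← punchIn-surjective (v≢w ∘ sym) =
    contradiction (∈colors⁺ (del v G) uw) lost

  ∑-lostEdges : ∑ lostEdges ≤ m[ G ] * 2
  ∑-lostEdges = ∑-filter≤ incident? edges (λ {e} _ → proj₁ e , proj₂ e , λ _ inc → inc)

  ∑-lostColors : ∑ lostColors ≤ c[ G ] * 2
  ∑-lostColors = ∑-filter≤ (λ v → _∉? colors (del v G)) (colors G) λ γ∈ →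
    let (u , w , _ , uw , eq) = ∈colors⁻ G γ∈ in
    u , w , λ v lost → lost-color-incident uw (subst (_∉ _) eq lost)
    where open DecMembership _≟_ using (_∉?_)

  private
    nbr? : ∀ v → Decidable (λ i → Adj v (punchIn v i))
    nbr? v i = adj? v (punchIn v i)

    edgeTo : Fin (suc n) → Fin n → Fin (suc n) × Fin (suc n)
    edgeTo v i with v <? punchIn v i
    ... | yes _ = v , punchIn v i
    ... | no _ = punchIn v i , v

    edgeTo-> : ∀ {v i} → v F.< punchIn v i → edgeTo v i ≡ (v , punchIn v i)
    edgeTo-> {v} {i} v< with v <? punchIn v i
    ... | yes _ = refl
    ... | no ¬v< = contradiction v< ¬v<

    edgeTo-< : ∀ {v i} → punchIn v i F.< v → edgeTo v i ≡ (punchIn v i , v)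
    edgeTo-< {v} {i} <v with v <? punchIn v i
    ... | yes v< = contradiction v< (ℕ.<⇒≯ <v)
    ... | no _ = refl

    lostEdges≤nbrs : ∀ v → lostEdges v ≤ # (nbr? v)
    lostEdges≤nbrs v = subst (lostEdges v ≤_) (length-map (edgeTo v) (filter (nbr? v) (allFin n)))
      (length-⊆ (Unique.filter⁺ (incident? v) (edges-unique graph)) at-v)
      where
      at-v : ∀ {e} → e ∈ filter (incident? v) edges → e ∈ map (edgeTo v) (filter (nbr? v) (allFin n))
      at-v {u , w} e∈ with ∈-filter⁻ (incident? v) {xs = edges} e∈
      ... | e∈G , inc with ∈edges⁻ graph e∈G | inc
      ... | v<w , vw | inj₁ refl with i , refl ← punchIn-surjective (Fin.<⇒≢ v<w ∘ sym) =
        subst (_∈ _) (edgeTo-> v<w) (∈-map⁺ (edgeTo v) (∈#⁺ (nbr? v) vw))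
      ... | u<v , uv | inj₂ refl with i , refl ← punchIn-surjective (Fin.<⇒≢ u<v) =
        subst (_∈ _) (edgeTo-< u<v) (∈-map⁺ (edgeTo v) (∈#⁺ (nbr? v) (adj-sym uv)))

  lostEdges≤n : ∀ v → lostEdges v ≤ n
  lostEdges≤n v = ℕ.≤-trans (lostEdges≤nbrs v) (#≤n (nbr? v))

  lostEdges≥n⇒Adj : ∀ v → n ≤ lostEdges v → ∀ {w} → v ≢ w → Adj v w
  lostEdges≥n⇒Adj v n≤ v≢w with i , refl ← punchIn-surjective (v≢w ∘ sym) =
    #≥n⇒∀ (nbr? v) (ℕ.≤-trans n≤ (lostEdges≤nbrs v)) i

-- A vertex of below-average loss

∑-max : (f : Fin n → ℕ) {b : ℕ} → ∑ f < n * b → ∃ λ v → f v < b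
∑-max {n} f {b} ∑< with Fin.any? (λ v → f v ℕ.<? b)
... | yes p = p
... | no ∄ = contradiction (subst (_≤ ∑ f) (∑-const n b) (∑-mono (λ v → ℕ.≮⇒≥ (λ lt → ∄ (v , lt)))))
  (ℕ.<⇒≱ ∑<)

module _ (q : ℕ) .{{_ : NonZero q}} where

  -- X * 2 bounds the sum of the losses over all vertices, as an edge or a color
  -- is lost with at most two of them; so some loss is below average.
  t-average : ∀ N X → suc q ≤ N → suc N C 2 + t (suc N) q + 1 ≤ X →
              X * 2 + suc N * (N C 2 + t N q) < suc N * X
  t-average (suc N′) X q<N f<X = ℕ.≤-trans (ℕ.≤-reflexive (sym (ℕ.+-suc _ _)))
    (ℕ.≤-trans (ℕ.+-monoʳ-≤ (X * 2) (ℕ.≤-trans bound (ℕ.*-monoʳ-≤ N′ f<X))) (ℕ.≤-reflexive (expand N′ X)))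
    where
    N M r a E W U : ℕ
    N = suc N′
    M = suc N
    r = N % q
    a = N / q
    E = N C 2
    W = suc r * suc a
    U = t M q

    expand : ∀ N X → X * 2 + N * X ≡ suc (suc N) * X
    expand = solve-∀

    N≡ : N ≡ r + a * q
    N≡ = m≡m%n+[m/n]*n N q

    1≤a : 1 ≤ a
    1≤a = m≥n⇒m/n>0 (ℕ.<⇒≤ q<N)

    -- `W` is the correction term of `t-closed` at `suc N`. Once `a` is positive, the product is
    -- below 3 only for `r = 0` and `a = 1`, that is, for `N = q`. The inequality `bound` is
    -- equivalent to this one.
    3≤W : 3 ≤ W
    3≤W with r in eqr | a in eqa
    ... | suc r′ | zero = contradiction 1≤a (subst (λ x → ¬ 1 ≤ x) (sym eqa) λ ())
    ... | zero | zero = contradiction 1≤a (subst (λ x → ¬ 1 ≤ x) (sym eqa) λ ())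
    ... | zero | suc (suc a′) = s≤s (s≤s (s≤s z≤n))
    ... | suc r′ | suc a′ = ℕ.≤-trans (ℕ.n≤1+n 3) (ℕ.*-mono-≤ {2} {suc (suc r′)} {2} {suc (suc a′)} (s≤s (s≤s z≤n)) (s≤s (s≤s z≤n)))
    ... | zero | suc zero = contradiction q<N (ℕ.<⇒≱ (s≤s (ℕ.≤-reflexive
      (trans N≡ (trans (cong₂ (λ x y → x + y * q) eqr eqa) (ℕ.+-identityʳ q))))))

    closed : 2 * U + (M * a + W) ≡ M * M
    closed = subst (λ x → 2 * t (suc x) q + (suc x * a + W) ≡ suc x * suc x) (sym N≡)
      (t-closed q a (suc r) (m%n<n N q))

    t-step : U + a ≡ t N q + N
    t-step = t-suc q N

    bound : suc (M * (E + t N q)) ≤ N′ * (M C 2 + U + 1)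
    -- The summand added to both sides supplies the terms that `t-step`, `closed` and `2C2` need, as
    -- these are equations without subtraction.
    bound = ℕ.+-cancelʳ-≤ (M * N + N + 2 * U + M * a + W) _ _ (begin
      suc (M * (E + t N q)) + (M * N + N + 2 * U + M * a + W)
        ≡⟨ e₁ N′ E (t N q) U a W ⟩
      M * (E + (t N q + N)) + (1 + N + (2 * U + (M * a + W)))
        ≡⟨ cong₂ (λ x y → M * (E + x) + (1 + N + y)) (sym t-step) closed ⟩
      M * (E + (U + a)) + (1 + N + M * M)
        ≡⟨ e₂ N′ E U a ⟩
      N′ * (E + U) + (2 * E + N) + 2 * U + M * a + (1 + M * M)
        ≡⟨ cong (λ x → N′ * (E + U) + x + 2 * U + M * a + (1 + M * M)) (2C2 N) ⟩
      N′ * (E + U) + N * N + 2 * U + M * a + (1 + M * M)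
        ≡⟨ e₃ N′ E U a ⟩
      3 + (N′ * ((E + N) + U + 1) + (M * N + N + 2 * U + M * a))
        ≤⟨ ℕ.+-monoˡ-≤ _ 3≤W ⟩
      W + (N′ * ((E + N) + U + 1) + (M * N + N + 2 * U + M * a))
        ≡⟨ e₄ W (N′ * ((E + N) + U + 1)) _ ⟩
      N′ * ((E + N) + U + 1) + (M * N + N + 2 * U + M * a + W)
        ≡⟨ cong (λ x → N′ * (x + U + 1) + (M * N + N + 2 * U + M * a + W)) (sym (C2-suc N)) ⟩
      N′ * (M C 2 + U + 1) + (M * N + N + 2 * U + M * a + W) ∎)
      where
      open ℕ.≤-Reasoning
      e₁ : ∀ N′ E T U a W →
        suc ((2 + N′) * (E + T)) + ((2 + N′) * (1 + N′) + (1 + N′) + 2 * U + (2 + N′) * a + W)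
        ≡ (2 + N′) * (E + (T + (1 + N′))) + (1 + (1 + N′) + (2 * U + ((2 + N′) * a + W)))
      e₁ = solve-∀
      e₂ : ∀ N′ E U a →
        (2 + N′) * (E + (U + a)) + (1 + (1 + N′) + (2 + N′) * (2 + N′))
        ≡ N′ * (E + U) + (2 * E + (1 + N′)) + 2 * U + (2 + N′) * a + (1 + (2 + N′) * (2 + N′))
      e₂ = solve-∀
      e₃ : ∀ N′ E U a →
        N′ * (E + U) + (1 + N′) * (1 + N′) + 2 * U + (2 + N′) * a + (1 + (2 + N′) * (2 + N′))
        ≡ 3 + (N′ * ((E + (1 + N′)) + U + 1) + ((2 + N′) * (1 + N′) + (1 + N′) + 2 * U + (2 + N′) * a))
      e₃ = solve-∀
      e₄ : ∀ W x y → W + (x + y) ≡ x + (y + W)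
      e₄ = solve-∀

  -- The constant `n C 2 + t n q` is carried inside the sum, so that no subtraction occurs. The
  -- strict inequality yields the final `+ 1` of the threshold for the smaller graph.
  cheap-vertex : (G : EdgeColoredGraph (suc n)) → suc q ≤ n →
    suc n C 2 + t (suc n) q + 1 ≤ m[ G ] + c[ G ] →
    ∃ λ v → lostEdges G v + lostColors G v + (n C 2 + t n q) < m[ G ] + c[ G ]
  cheap-vertex {n} G q<n f<X = ∑-max loss (ℕ.≤-<-trans
    (begin
      ∑ loss
        ≡⟨ ∑-distrib-+ (λ v → lostEdges G v + lostColors G v) (λ _ → n C 2 + t n q) ⟩
      ∑ (λ v → lostEdges G v + lostColors G v) + ∑ {suc n} (λ _ → n C 2 + t n q)
        ≡⟨ cong₂ _+_ (∑-distrib-+ (lostEdges G) (lostColors G)) (∑-const (suc n) _) ⟩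
      ∑ (lostEdges G) + ∑ (lostColors G) + suc n * (n C 2 + t n q)
        ≤⟨ ℕ.+-monoˡ-≤ _ (ℕ.+-mono-≤ (∑-lostEdges G) (∑-lostColors G)) ⟩
      m[ G ] * 2 + c[ G ] * 2 + suc n * (n C 2 + t n q)
        ≡⟨ cong (_+ suc n * (n C 2 + t n q)) (sym (ℕ.*-distribʳ-+ 2 m[ G ] c[ G ])) ⟩
      (m[ G ] + c[ G ]) * 2 + suc n * (n C 2 + t n q) ∎)
    (t-average n _ q<n f<X))
    where
    open ℕ.≤-Reasoning
    loss : Fin (suc n) → ℕ
    loss v = lostEdges G v + lostColors G v + (n C 2 + t n q)

-- Rainbow cliques

module _ (F : Graph m) (G : EdgeColoredGraph n) where
  private
    module E = Graph F
    module C = EdgeColoredGraph G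

  -- Symmetry of adjacency and of colors reduces everything to increasing pairs, where two equal
  -- unordered pairs agree endpoint by endpoint.
  rainbow-ordered : (f : Fin m → Fin n) →
    (∀ {u v x y} → u F.< v → x F.< y → E.Adj u v → E.Adj x y →
      C.color (f u) (f v) ≡ C.color (f x) (f y) → u ≡ x × v ≡ y) →
    ∀ {u v x y} → E.Adj u v → E.Adj x y → C.color (f u) (f v) ≡ C.color (f x) (f y) →
    (u ≡ x × v ≡ y) ⊎ (u ≡ y × v ≡ x)
  rainbow-ordered f ord {u} {v} {x} {y} uv xy eq with Fin.<-cmp u v | Fin.<-cmp x y
  ... | tri≈ _ refl _ | _ = contradiction uv E.adj-irrefl
  ... | tri< _ _ _ | tri≈ _ refl _ = contradiction xy E.adj-irrefl
  ... | tri> _ _ _ | tri≈ _ refl _ = contradiction xy E.adj-irrefl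
  ... | tri< u<v _ _ | tri< x<y _ _ = inj₁ (ord u<v x<y uv xy eq)
  ... | tri< u<v _ _ | tri> _ _ y<x =
    inj₂ (ord u<v y<x uv (E.adj-sym xy) (trans eq (C.color-sym _ _)))
  ... | tri> _ _ v<u | tri< x<y _ _ =
    let a , b = ord v<u x<y (E.adj-sym uv) xy (trans (C.color-sym _ _) eq) in inj₂ (b , a)
  ... | tri> _ _ v<u | tri> _ _ y<x =
    let a , b = ord v<u y<x (E.adj-sym uv) (E.adj-sym xy) (trans (C.color-sym _ _) (trans eq (C.color-sym _ _)))
    in inj₁ (b , a)

pullback-copy : {F : Graph s} {G : EdgeColoredGraph n} {ι : Fin m → Fin n} →
                Injective _≡_ _≡_ ι → RainbowCopy F (pullback ι G) → RainbowCopy F G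
pullback-copy {ι = ι} ι-inj c = record
  { embed = ι ∘ embed ; injective = injective ∘ ι-inj ; preserves = preserves ; rainbow = rainbow }
  where open RainbowCopy c

module _ {G : EdgeColoredGraph n} where
  open EdgeColoredGraph G hiding (m[_]; c[_])

  addVertex : (c : RainbowCopy (K s) G) (x : Fin n) → let open RainbowCopy c in
    (∀ i → Adj x (embed i)) →
    (∀ {i j} → color x (embed i) ≡ color x (embed j) → i ≡ j) →
    (∀ {i j k} → j ≢ k → color x (embed i) ≢ color (embed j) (embed k)) →
    RainbowCopy (K (suc s)) G
  addVertex {s} c x adj inj fresh = record
    { embed = f
    ; injective = f-injective _ _
    ; preserves = f-preserves _ _
    ; rainbow = rainbow-ordered (K (suc s)) G f ordered
    }
    where
    open RainbowCopy c
    f : Fin (suc s) → Fin n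
    f = x ◂ embed
    f-injective : ∀ i j → f i ≡ f j → i ≡ j
    f-injective zero zero _ = refl
    f-injective zero (suc j) e = contradiction e (Adj⇒≢ graph (adj j))
    f-injective (suc i) zero e = contradiction (sym e) (Adj⇒≢ graph (adj i))
    f-injective (suc i) (suc j) e = cong suc (injective e)
    f-preserves : ∀ i j → i ≢ j → Adj (f i) (f j)
    f-preserves zero zero i≢j = contradiction refl i≢j
    f-preserves zero (suc j) _ = adj j
    f-preserves (suc i) zero _ = adj-sym (adj i)
    f-preserves (suc i) (suc j) i≢j = preserves (i≢j ∘ cong suc)
    ordered : ∀ {u v w y} → u F.< v → w F.< y → u ≢ v → w ≢ y →
              color (f u) (f v) ≡ color (f w) (f y) → u ≡ w × v ≡ y
    ordered {zero} {suc v} {zero} {suc y} _ _ _ _ e = refl , cong suc (inj e)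
    ordered {zero} {suc v} {suc w} {suc y} _ _ _ w≢y e = contradiction e (fresh (w≢y ∘ cong suc))
    ordered {suc u} {suc v} {zero} {suc y} _ _ u≢v _ e = contradiction (sym e) (fresh (u≢v ∘ cong suc))
    ordered {suc u} {suc v} {suc w} {suc y} (s≤s u<v) (s≤s w<y) u≢v w≢y e
      with rainbow (u≢v ∘ cong suc) (w≢y ∘ cong suc) e
    ... | inj₁ (a , b) = cong suc a , cong suc b
    ... | inj₂ (refl , refl) = contradiction u<v (ℕ.<⇒≯ w<y)

-- Twins over a rainbow complete multipartite graph

module Multipartite {q : ℕ} (G : EdgeColoredGraph n) (complete : Complete G) (pt : Fin n → Fin q)
  (rainbow-pt : ∀ {i j k l} → pt i ≢ pt j → pt k ≢ pt l →
                EdgeColoredGraph.color G i j ≡ EdgeColoredGraph.color G k l →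
                (i ≡ k × j ≡ l) ⊎ (i ≡ l × j ≡ k)) where
  open EdgeColoredGraph G hiding (m[_]; c[_])

  Transversal : Set
  Transversal = ∃ λ (τ : Fin q → Fin n) → ∀ r → pt (τ r) ≡ r

  New : Color → Set
  New γ = ∀ a b → pt a ≢ pt b → color a b ≢ γ

  -- This covers both a new color and the color of a single cross edge at `y`: for a clique that
  -- avoids `y`, either behaves as new.
  OnlyAt : Fin n → Color → Set
  OnlyAt y γ = ∀ a b → pt a ≢ pt b → color a b ≡ γ → a ≡ y ⊎ b ≡ y

  override : Transversal → Fin n → Transversal
  override (τ , τ∈) w = τ′ , τ′∈
    where
    τ′ : Fin q → Fin n
    τ′ r with r Fin.≟ pt w
    ... | yes _ = w
    ... | no _ = τ r
    τ′∈ : ∀ r → pt (τ′ r) ≡ r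
    τ′∈ r with r Fin.≟ pt w
    ... | yes e = sym e
    ... | no _ = τ∈ r

  override-at : ∀ S w → proj₁ (override S w) (pt w) ≡ w
  override-at S w with pt w Fin.≟ pt w
  ... | yes _ = refl
  ... | no ≢ = contradiction refl ≢

  override-off : ∀ S w {r} → r ≢ pt w → proj₁ (override S w) r ≡ proj₁ S r
  override-off S w {r} r≢ with r Fin.≟ pt w
  ... | yes e = contradiction e r≢
  ... | no _ = refl

  override-all : (P : Fin n → Set) → ∀ S w → P w → (∀ r → r ≢ pt w → P (proj₁ S r)) → ∀ r → P (proj₁ (override S w) r)
  override-all P S w pw pT r with r Fin.≟ pt w
  ... | yes _ = pw
  ... | no r≢ = pT r r≢

  transversal-copy : Transversal → RainbowCopy (K q) G
  transversal-copy (τ , τ∈) = record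
    { embed = τ
    ; injective = τ-injective
    ; preserves = λ u≢v → complete (u≢v ∘ τ-injective)
    ; rainbow = λ u≢v x≢y e → Sum.map
        (λ (a , b) → τ-injective a , τ-injective b) (λ (a , b) → τ-injective a , τ-injective b)
        (rainbow-pt (λ p → u≢v (trans (sym (τ∈ _)) (trans p (τ∈ _))))
                    (λ p → x≢y (trans (sym (τ∈ _)) (trans p (τ∈ _)))) e)
    }
    where
    τ-injective : ∀ {r r′} → τ r ≡ τ r′ → r ≡ r′
    τ-injective e = trans (sym (τ∈ _)) (trans (cong pt e) (τ∈ _))

  -- Apart from the twin edge, all edges from `x` to the clique are cross edges. By `rainbow-pt`
  -- these can clash only with an edge of the clique inside a part. The clique need not be a
  -- transversal, so that a second twin can be added after a first.
  addTwin : (c : RainbowCopy (K s) G) (x : Fin n) (i₀ : Fin s) → let open RainbowCopy c in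
    x ≢ embed i₀ →
    (∀ {i} → pt (embed i) ≡ pt x → i ≡ i₀) →
    (∀ {j k} → j ≢ k → color x (embed i₀) ≢ color (embed j) (embed k)) →
    (∀ {i} → i ≢ i₀ → color x (embed i₀) ≢ color x (embed i)) →
    (∀ {i j k} → i ≢ i₀ → j ≢ k → pt (embed j) ≡ pt (embed k) →
      color x (embed i) ≢ color (embed j) (embed k)) →
    RainbowCopy (K (suc s)) G
  addTwin c x i₀ x≢twin only-twin new₁ new₂ new₃ =
    addVertex c x (λ i → complete (x∉ i)) (inj _ _) (fresh _ _ _)
    where
    open RainbowCopy c
    x∉ : ∀ i → x ≢ embed i
    x∉ i e with only-twin (cong pt (sym e))
    ... | refl = x≢twin e
    cross : ∀ {i} → i ≢ i₀ → pt x ≢ pt (embed i)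
    cross i≢ e = i≢ (only-twin (sym e))
    inj : ∀ i j → color x (embed i) ≡ color x (embed j) → i ≡ j
    inj i j e with i Fin.≟ i₀ | j Fin.≟ i₀
    ... | yes refl | yes refl = refl
    ... | yes refl | no j≢ = contradiction e (new₂ j≢)
    ... | no i≢ | yes refl = contradiction (sym e) (new₂ i≢)
    ... | no i≢ | no j≢ with rainbow-pt (cross i≢) (cross j≢) e
    ...   | inj₁ (_ , a) = injective a
    ...   | inj₂ (a , _) = contradiction a (x∉ j)
    fresh : ∀ i j k → j ≢ k → color x (embed i) ≢ color (embed j) (embed k)
    fresh i j k j≢k e with i Fin.≟ i₀ | pt (embed j) Fin.≟ pt (embed k)
    ... | yes refl | _ = new₁ j≢k e
    ... | no i≢ | yes p = new₃ i≢ j≢k p e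
    ... | no i≢ | no p with rainbow-pt (cross i≢) p e
    ...   | inj₁ (a , _) = x∉ j a
    ...   | inj₂ (a , _) = x∉ k a

  module _ (S : Transversal) (x : Fin n) where
    private
      τ = proj₁ S
      τ∈ = proj₂ S
      pt-τ : ∀ {r r′} → pt (τ r) ≡ pt (τ r′) → r ≡ r′
      pt-τ e = trans (sym (τ∈ _)) (trans e (τ∈ _))

    twin-copy : x ≢ τ (pt x) →
      (∀ {r r′} → r ≢ r′ → color x (τ (pt x)) ≢ color (τ r) (τ r′)) →
      (∀ {r} → r ≢ pt x → color x (τ (pt x)) ≢ color x (τ r)) →
      RainbowCopy (K (suc q)) G
    twin-copy x≢ new₁ new₂ = addTwin (transversal-copy S) x (pt x) x≢
      (λ e → trans (sym (τ∈ _)) e) new₁ new₂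
      (λ _ j≢k e → contradiction (pt-τ e) j≢k)

    twin-copy-new : x ≢ τ (pt x) → New (color x (τ (pt x))) → RainbowCopy (K (suc q)) G
    twin-copy-new x≢ new = twin-copy x≢
      (λ r≢ e → new _ _ (λ p → r≢ (pt-τ p)) (sym e))
      (λ r≢ e → new _ _ (λ p → r≢ (sym (trans p (τ∈ _)))) (sym e))

  module _ (no-copy : ¬ RainbowCopy (K (2 + q)) G)
           (two : ∀ r → ∃₂ λ a b → a ≢ b × pt a ≡ r × pt b ≡ r) where

    private
      avoid : Fin n → Transversal
      avoid y = (λ r → proj₁ (choose r)) , (λ r → proj₁ (proj₂ (choose r)))
        where
        choose : ∀ r → ∃ λ a → pt a ≡ r × a ≢ y
        choose r with two r
        ... | a , b , a≢b , pa , pb with a Fin.≟ y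
        ...   | no a≢y = a , pa , a≢y
        ...   | yes refl = b , pb , a≢b ∘ sym

      avoid-≢ : ∀ y r → proj₁ (avoid y) r ≢ y
      avoid-≢ y r with two r
      ... | a , b , a≢b , pa , pb with a Fin.≟ y
      ...   | no a≢y = a≢y
      ...   | yes refl = a≢b ∘ sym

    -- Take a transversal through `p` and `w` that avoids `y`, which exists as every part has two
    -- vertices, and add the twins `p′` and `w′`. Away from `y` neither twin color occurs on a cross
    -- edge, so the result would be a rainbow clique on `2 + q` vertices.
    two-twins : ∀ {p p′ w w′ y} → p ≢ p′ → pt p ≡ pt p′ → w ≢ w′ → pt w ≡ pt w′ → pt p ≢ pt w →
      p ≢ y → p′ ≢ y → w ≢ y → w′ ≢ y → color p p′ ≢ color w w′ →
      ¬ (OnlyAt y (color p p′) × OnlyAt y (color w w′))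
    two-twins {p} {p′} {w} {w′} {y} p≢p′ pp′ w≢w′ ww′ p≁w p≢y p′≢y w≢y w′≢y pp′≢ww′ (only₁ , only₂) =
      no-copy (addTwin c₁ w′ (suc (pt w))
        (λ e → w≢w′ (sym (trans e τw)))
        (λ {i} → twin-only i)
        (λ {j} {k} → new₁ j k)
        (λ {i} i≢ e → missed₂ w′≢y (f≢y i) (λ q → i≢ (twin-only i (sym q))) (trans (sym e) w′w))
        (λ {i} {j} {k} i≢ j≢k jk e → missed₁ w′≢y (f≢y i) (λ q → i≢ (twin-only i (sym q))) (trans e (inside j k j≢k jk))))
      where
      S : Transversal
      S = override (override (avoid y) p) w
      τ : Fin q → Fin n
      τ = proj₁ S
      τw : τ (pt w) ≡ w
      τw = override-at (override (avoid y) p) w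
      τp : τ (pt p) ≡ p
      τp = trans (override-off (override (avoid y) p) w p≁w) (override-at (avoid y) p)
      τp′ : τ (pt p′) ≡ p
      τp′ = trans (cong τ (sym pp′)) τp
      τ≢y : ∀ r → τ r ≢ y
      τ≢y = override-all (_≢ y) (override (avoid y) p) w w≢y
        (λ r _ → override-all (_≢ y) (avoid y) p p≢y (λ r′ _ → avoid-≢ y r′) r)
      missed₁ : ∀ {a b} → a ≢ y → b ≢ y → pt a ≢ pt b → color a b ≢ color p p′
      missed₁ a≢y b≢y a≁b e with only₁ _ _ a≁b e
      ... | inj₁ a≡y = a≢y a≡y
      ... | inj₂ b≡y = b≢y b≡y
      missed₂ : ∀ {a b} → a ≢ y → b ≢ y → pt a ≢ pt b → color a b ≢ color w w′
      missed₂ a≢y b≢y a≁b e with only₂ _ _ a≁b e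
      ... | inj₁ a≡y = a≢y a≡y
      ... | inj₂ b≡y = b≢y b≡y
      p′p : color p′ (τ (pt p′)) ≡ color p p′
      p′p = trans (cong (color p′) τp′) (color-sym p′ p)
      τ-cross : ∀ {r r′} → r ≢ r′ → pt (τ r) ≢ pt (τ r′)
      τ-cross {r} {r′} r≢ e = r≢ (trans (sym (proj₂ S r)) (trans e (proj₂ S r′)))
      c₁ : RainbowCopy (K (suc q)) G
      c₁ = twin-copy S p′ (λ e → p≢p′ (sym (trans e τp′)))
        (λ {r} {r′} r≢ e → missed₁ (τ≢y r) (τ≢y r′) (τ-cross r≢) (trans (sym e) p′p))
        (λ {r} r≢ e → missed₁ p′≢y (τ≢y r) (λ p → r≢ (sym (trans p (proj₂ S r)))) (trans (sym e) p′p))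
      f : Fin (suc q) → Fin n
      f = RainbowCopy.embed c₁
      f≢y : ∀ i → f i ≢ y
      f≢y zero = p′≢y
      f≢y (suc r) = τ≢y r
      twin-only : ∀ i → pt (f i) ≡ pt w′ → i ≡ suc (pt w)
      twin-only zero e = contradiction (trans pp′ (trans e (sym ww′))) p≁w
      twin-only (suc r) e = cong suc (trans (sym (proj₂ S r)) (trans e (sym ww′)))
      w′w : color w′ (τ (pt w)) ≡ color w w′
      w′w = trans (cong (color w′) τw) (color-sym w′ w)
      -- The only two vertices of `c₁` in a common part are `p′` and `p`.
      inside : ∀ j k → j ≢ k → pt (f j) ≡ pt (f k) → color (f j) (f k) ≡ color p p′
      inside zero zero j≢k _ = contradiction refl j≢k
      inside zero (suc k) _ e = trans (cong (λ r → color p′ (τ r)) (sym (trans e (proj₂ S k)))) p′p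
      inside (suc j) zero _ e = trans (color-sym _ _)
        (trans (cong (λ r → color p′ (τ r)) (trans (sym (proj₂ S j)) e)) p′p)
      inside (suc j) (suc k) j≢k e = contradiction e (τ-cross (j≢k ∘ cong suc))
      new₁ : ∀ j k → j ≢ k → color w′ (τ (pt w)) ≢ color (f j) (f k)
      new₁ j k j≢k e with pt (f j) Fin.≟ pt (f k)
      ... | yes jk = pp′≢ww′ (sym (trans (sym w′w) (trans e (inside j k j≢k jk))))
      ... | no jk = missed₂ (f≢y j) (f≢y k) jk (trans (sym e) w′w)

    private
      onlyAt : ∀ {x y γ} → pt x ≢ pt y → γ ≡ color x y → OnlyAt y γ
      onlyAt x≁y γ≡ _ _ a≁b e with rainbow-pt a≁b x≁y (trans e γ≡)
      ... | inj₁ (_ , b≡y) = inj₂ b≡y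
      ... | inj₂ (a≡y , _) = inj₁ a≡y

      onlyAt-new : ∀ {y γ} → New γ → OnlyAt y γ
      onlyAt-new new _ _ a≁b e = contradiction e (new _ _ a≁b)

    private
      -- Otherwise `y` is none of the four vertices. The color of `pp′` occurs on the cross edge
      -- `xy` alone and that of `zz′` on no cross edge, so `two-twins` applies.
      ends : ∀ {p p′ z z′ x y} → p ≢ p′ → pt p ≡ pt p′ → z ≢ z′ → pt z ≡ pt z′ → pt p ≢ pt z →
        New (color z z′) → pt x ≢ pt y → color p p′ ≡ color x y → pt y ≡ pt p ⊎ (y ≡ z ⊎ y ≡ z′)
      ends {p} {p′} {z} {z′} {x} {y} p≢ pp′ z≢ zz′ p≁z new x≁y e
        with p Fin.≟ y | p′ Fin.≟ y | z Fin.≟ y | z′ Fin.≟ y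
      ... | yes refl | _ | _ | _ = inj₁ refl
      ... | no _ | yes refl | _ | _ = inj₁ (sym pp′)
      ... | no _ | no _ | yes refl | _ = inj₂ (inj₁ refl)
      ... | no _ | no _ | no _ | yes refl = inj₂ (inj₂ refl)
      ... | no a | no b | no c | no d = contradiction
        (onlyAt x≁y e , onlyAt-new new)
        (two-twins p≢ pp′ z≢ zz′ p≁z a b c d (λ e′ → new _ _ x≁y (trans (sym e) e′)))

      part-of : ∀ {z z′ y} → pt z ≡ pt z′ → y ≡ z ⊎ y ≡ z′ → pt y ≡ pt z
      part-of zz′ (inj₁ refl) = refl
      part-of zz′ (inj₂ refl) = sym zz′

      Attached : (p p′ z z′ : Fin n) → Fin n → Set
      Attached p p′ z z′ y = (y ≡ z ⊎ y ≡ z′) × ∃ λ x → pt x ≡ pt p × color p p′ ≡ color x y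

      -- `ends` holds at both endpoints of the cross edge. They lie in different parts, so one is in
      -- the part of `p` and the other is `z` or `z′`.
      attached : ∀ {p p′ z z′} → p ≢ p′ → pt p ≡ pt p′ → z ≢ z′ → pt z ≡ pt z′ → pt p ≢ pt z →
        New (color z z′) → (∃₂ λ x y → pt x ≢ pt y × color p p′ ≡ color x y) → ∃ (Attached p p′ z z′)
      attached p≢ pp′ z≢ zz′ p≁z new (x , y , x≁y , e)
        with ends p≢ pp′ z≢ zz′ p≁z new x≁y e
           | ends p≢ pp′ z≢ zz′ p≁z new (x≁y ∘ sym) (trans e (color-sym x y))
      ... | inj₁ a | inj₁ b = contradiction (trans b (sym a)) x≁y
      ... | inj₁ a | inj₂ b = x , b , y , a , trans e (color-sym x y)
      ... | inj₂ b | inj₁ a = y , b , x , a , e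
      ... | inj₂ a | inj₂ b = contradiction (trans (part-of zz′ b) (sym (part-of zz′ a))) x≁y

    Old : Color → Set
    Old γ = ∃₂ λ x y → pt x ≢ pt y × γ ≡ color x y

    -- The unique cross edge with the color of `pp′` would have to run from the part of `p` both to
    -- `z` or `z′` and to `w` or `w′`.
    three-parts : ∀ {p p′ z z′ w w′} → p ≢ p′ → pt p ≡ pt p′ → z ≢ z′ → pt z ≡ pt z′ →
      w ≢ w′ → pt w ≡ pt w′ → pt p ≢ pt z → pt p ≢ pt w → pt z ≢ pt w →
      New (color z z′) → New (color w w′) → ¬ Old (color p p′)
    three-parts p≢ pp′ z≢ zz′ w≢ ww′ p≁z p≁w z≁w new₁ new₂ old
      with y₁ , y₁∈ , x₁ , px₁ , e₁ ← attached p≢ pp′ z≢ zz′ p≁z new₁ old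
         | y₂ , y₂∈ , x₂ , px₂ , e₂ ← attached p≢ pp′ w≢ ww′ p≁w new₂ old
      with part-of zz′ y₁∈ | part-of ww′ y₂∈
    ... | py₁ | py₂ with rainbow-pt (λ e → p≁z (trans (sym px₁) (trans e py₁)))
                                    (λ e → p≁w (trans (sym px₂) (trans e py₂)))
                                    (trans (sym e₁) e₂)
    ...   | inj₁ (_ , refl) = z≁w (trans (sym py₁) py₂)
    ...   | inj₂ (_ , refl) = p≁z (trans (sym px₂) py₁)

    -- With a common `y`, both colors occur on cross edges only at `y`, and they differ because the
    -- other ends lie in different parts; this contradicts `two-twins`.
    attached-≢ : ∀ {p p′ w w′ z z′ y y′} → p ≢ p′ → pt p ≡ pt p′ → w ≢ w′ → pt w ≡ pt w′ → pt z ≡ pt z′ →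
      pt p ≢ pt w → pt p ≢ pt z → pt w ≢ pt z →
      Attached p p′ z z′ y → Attached w w′ z z′ y′ → y ≢ y′
    attached-≢ p≢ pp′ w≢ ww′ zz′ p≁w p≁z w≁z (y∈ , x , px , e) (_ , x′ , px′ , e′) refl =
      two-twins p≢ pp′ w≢ ww′ p≁w
        (λ { refl → p≁z py }) (λ { refl → p≁z (trans pp′ py) })
        (λ { refl → w≁z py }) (λ { refl → w≁z (trans ww′ py) })
        (λ eq → case rainbow-pt x≁y x′≁y (trans (sym e) (trans eq e′)) of λ
          { (inj₁ (refl , _)) → p≁w (trans (sym px) px′)
          ; (inj₂ (refl , _)) → x≁y refl })
        (onlyAt x≁y e , onlyAt x′≁y e′)
      where
      py = part-of zz′ y∈
      x≁y = λ e → p≁z (trans (sym px) (trans e py))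
      x′≁y = λ e → w≁z (trans (sym px′) (trans e py))

    module _ (4≤q : 4 ≤ q) {z z′ : Fin n} (z≢z′ : z ≢ z′) (zz′ : pt z ≡ pt z′) (new : New (color z z′))
             (new-or-old : ∀ {p p′} → p ≢ p′ → pt p ≡ pt p′ → color p p′ ≡ color z z′ ⊎ Old (color p p′)) where

      private
        a b : Fin q → Fin n
        a r = proj₁ (two r)
        b r = proj₁ (proj₂ (two r))
        a≢b : ∀ r → a r ≢ b r
        a≢b r = proj₁ (proj₂ (proj₂ (two r)))
        pa : ∀ r → pt (a r) ≡ r
        pa r = proj₁ (proj₂ (proj₂ (proj₂ (two r))))
        pab : ∀ r → pt (a r) ≡ pt (b r)
        pab r = trans (pa r) (sym (proj₂ (proj₂ (proj₂ (proj₂ (two r))))))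

        Like-z : Fin q → Set
        Like-z r = color (a r) (b r) ≡ color z z′

        like-z? : ∀ r → Like-z r ⊎ Old (color (a r) (b r))
        like-z? r = new-or-old (a≢b r) (pab r)

        -- By `attached-≢` the three pairs are attached to distinct vertices, but only `z` and `z′`
        -- are available.
        three-old : ∀ {r₁ r₂ r₃} → r₁ ≢ pt z → r₂ ≢ pt z → r₃ ≢ pt z → r₁ ≢ r₂ → r₁ ≢ r₃ → r₂ ≢ r₃ →
          Old (color (a r₁) (b r₁)) → Old (color (a r₂) (b r₂)) → ¬ Old (color (a r₃) (b r₃))
        three-old {r₁} {r₂} {r₃} n₁ n₂ n₃ n₁₂ n₁₃ n₂₃ o₁ o₂ o₃ =
          pigeon (proj₁ (proj₂ A₁)) (proj₁ (proj₂ A₂)) (proj₁ (proj₂ A₃))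
            (differ n₁₂ n₁ n₂ (proj₂ A₁) (proj₂ A₂))
            (differ n₁₃ n₁ n₃ (proj₂ A₁) (proj₂ A₃))
            (differ n₂₃ n₂ n₃ (proj₂ A₂) (proj₂ A₃))
          where
          at : ∀ {r r′} → r ≢ r′ → pt (a r) ≢ r′
          at r≢ e = r≢ (trans (sym (pa _)) e)
          get : ∀ {r} → r ≢ pt z → Old (color (a r) (b r)) → ∃ (Attached (a r) (b r) z z′)
          get {r} r≢ o = attached (a≢b r) (pab r) z≢z′ zz′ (at r≢) new o
          A₁ = get n₁ o₁
          A₂ = get n₂ o₂
          A₃ = get n₃ o₃
          differ : ∀ {r r′ y y′} → r ≢ r′ → r ≢ pt z → r′ ≢ pt z →
            Attached (a r) (b r) z z′ y → Attached (a r′) (b r′) z z′ y′ → y ≢ y′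
          differ {r} {r′} r≢r′ nr nr′ = attached-≢ (a≢b r) (pab r) (a≢b r′) (pab r′) zz′
            (λ e → at r≢r′ (trans e (pa r′))) (at nr) (at nr′)
          pigeon : ∀ {y₁ y₂ y₃ : Fin n} → y₁ ≡ z ⊎ y₁ ≡ z′ → y₂ ≡ z ⊎ y₂ ≡ z′ → y₃ ≡ z ⊎ y₃ ≡ z′ →
            y₁ ≢ y₂ → y₁ ≢ y₃ → ¬ (y₂ ≢ y₃)
          pigeon (inj₁ refl) (inj₁ refl) _ d _ _ = d refl
          pigeon (inj₂ refl) (inj₂ refl) _ d _ _ = d refl
          pigeon (inj₁ refl) (inj₂ refl) (inj₁ refl) _ d _ = d refl
          pigeon (inj₁ refl) (inj₂ refl) (inj₂ refl) _ _ d = d refl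
          pigeon (inj₂ refl) (inj₁ refl) (inj₂ refl) _ d _ = d refl
          pigeon (inj₂ refl) (inj₁ refl) (inj₁ refl) _ _ d = d refl

        first-like : ∀ {r₁ r₂ r₃} → r₁ ≢ pt z → r₂ ≢ pt z → r₃ ≢ pt z → r₁ ≢ r₂ → r₁ ≢ r₃ → r₂ ≢ r₃ →
          ∃ λ r → r ≢ pt z × Like-z r
        first-like {r₁} {r₂} {r₃} n₁ n₂ n₃ n₁₂ n₁₃ n₂₃ with like-z? r₁ | like-z? r₂ | like-z? r₃
        ... | inj₁ l | _ | _ = r₁ , n₁ , l
        ... | inj₂ _ | inj₁ l | _ = r₂ , n₂ , l
        ... | inj₂ _ | inj₂ _ | inj₁ l = r₃ , n₃ , l
        ... | inj₂ o₁ | inj₂ o₂ | inj₂ o₃ = contradiction o₃ (three-old n₁ n₂ n₃ n₁₂ n₁₃ n₂₃ o₁ o₂)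

        part# : Fin 4 → Fin q
        part# i = inject≤ i 4≤q

        part#-≢ : ∀ {i j} → i ≢ j → part# i ≢ part# j
        part#-≢ i≢j e = i≢j (Fin.inject≤-injective 4≤q 4≤q _ _ e)

        r₀ r₁ r₂ r₃ : Fin q
        r₀ = part# zero
        r₁ = part# (suc zero)
        r₂ = part# (suc (suc zero))
        r₃ = part# (suc (suc (suc zero)))
        d₀₁ : r₀ ≢ r₁
        d₀₁ = part#-≢ λ ()
        d₀₂ : r₀ ≢ r₂
        d₀₂ = part#-≢ λ ()
        d₀₃ : r₀ ≢ r₃
        d₀₃ = part#-≢ λ ()
        d₁₂ : r₁ ≢ r₂
        d₁₂ = part#-≢ λ ()
        d₁₃ : r₁ ≢ r₃
        d₁₃ = part#-≢ λ ()
        d₂₃ : r₂ ≢ r₃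
        d₂₃ = part#-≢ λ ()

        -- Among four parts at least three differ from that of `z`, as `three-old` requires.
        another-like : ∃ λ r → r ≢ pt z × Like-z r
        another-like with r₀ Fin.≟ pt z | r₁ Fin.≟ pt z | r₂ Fin.≟ pt z
        ... | yes e | _ | _ = first-like (λ e′ → d₀₁ (trans e (sym e′))) (λ e′ → d₀₂ (trans e (sym e′)))
                                         (λ e′ → d₀₃ (trans e (sym e′))) d₁₂ d₁₃ d₂₃
        ... | no n₀ | yes e | _ = first-like n₀ (λ e′ → d₁₂ (trans e (sym e′))) (λ e′ → d₁₃ (trans e (sym e′)))
                                         d₀₂ d₀₃ d₂₃
        ... | no n₀ | no n₁ | yes e = first-like n₀ n₁ (λ e′ → d₂₃ (trans e (sym e′))) d₀₁ d₀₃ d₁₃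
        ... | no n₀ | no n₁ | no n₂ = first-like n₀ n₁ n₂ d₀₁ d₀₂ d₁₂

        third : ∀ r r′ → ∃ λ r″ → r″ ≢ r × r″ ≢ r′
        third r r′ with r₀ Fin.≟ r | r₀ Fin.≟ r′ | r₁ Fin.≟ r | r₁ Fin.≟ r′
        ... | no n | no n′ | _ | _ = r₀ , n , n′
        ... | yes _ | _ | no n | no n′ = r₁ , n , n′
        ... | no _ | yes _ | no n | no n′ = r₁ , n , n′
        ... | yes e | _ | yes e′ | _ = contradiction (trans e (sym e′)) d₀₁
        ... | yes e | _ | no _ | yes e′ = r₂ , (λ x → d₀₂ (trans e (sym x))) , (λ x → d₁₂ (trans e′ (sym x)))
        ... | no _ | yes e | yes e′ | _ = r₂ , (λ x → d₁₂ (trans e′ (sym x))) , (λ x → d₀₂ (trans e (sym x)))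
        ... | no _ | yes e | no _ | yes e′ = contradiction (trans e (sym e′)) d₀₁

        like-new : ∀ {r} → Like-z r → New (color (a r) (b r))
        like-new l = subst New (sym l) new

        at-≢ : ∀ {r r′} → r ≢ r′ → pt (a r) ≢ r′
        at-≢ r≢ e = r≢ (trans (sym (pa _)) e)

        old-impossible : ∀ {p p′ r} → p ≢ p′ → pt p ≡ pt p′ → pt p ≢ pt z → r ≢ pt z → pt p ≢ r → Like-z r →
          ¬ Old (color p p′)
        old-impossible {r = r} p≢ pp′ p≁z r≢z p≢r l = three-parts p≢ pp′ z≢z′ zz′ (a≢b r) (pab r) p≁z
          (λ e → p≢r (trans e (pa r))) (λ e → at-≢ r≢z (sym e)) new (like-new l)

      -- The parts of `z` and `r` already carry pairs of the new color, so by `three-parts` a third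
      -- part `r′` does too. At least two of these three parts differ from that of `p`, and
      -- `three-parts` then rules out an old color for `pp′`.
      inside-monochromatic : ∀ {p p′} → p ≢ p′ → pt p ≡ pt p′ → color p p′ ≡ color z z′
      inside-monochromatic {p} {p′} p≢ pp′
        with r , r≢z , l ← another-like
        with r′ , r′≢z , r′≢r ← third (pt z) r
        with new-or-old p≢ pp′ | like-z? r′
      ... | inj₁ e | _ = e
      ... | inj₂ _ | inj₂ old′ = contradiction old′
        (old-impossible (a≢b r′) (pab r′) (at-≢ r′≢z) r≢z (at-≢ r′≢r) l)
      ... | inj₂ old | inj₁ l′ with pt p Fin.≟ pt z | pt p Fin.≟ r
      ...   | no p≁z | no p≢r = contradiction old (old-impossible p≢ pp′ p≁z r≢z p≢r l)
      ...   | no p≁z | yes refl = contradiction old (old-impossible p≢ pp′ p≁z r′≢z (r′≢r ∘ sym) l′)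
      ...   | yes p~z | _ = contradiction old
        (three-parts p≢ pp′ (a≢b r) (pab r) (a≢b r′) (pab r′)
          (λ e → r≢z (sym (trans (sym p~z) (trans e (pa r)))))
          (λ e → r′≢z (sym (trans (sym p~z) (trans e (pa r′)))))
          (λ e → r′≢r (sym (trans (sym (pa r)) (trans e (pa r′)))))
          (like-new l) (like-new l′))

-- Rainbow Turán graphs

module _ (q : ℕ) .{{_ : NonZero q}} where

  pt : Fin n → Fin q
  pt v = toℕ v mod q

  toℕ-pt : (v : Fin n) → toℕ (pt v) ≡ part q v
  toℕ-pt v = Fin.toℕ-fromℕ< (m%n<n (toℕ v) q)

  pt⇒part : {u : Fin m} {v : Fin n} → pt u ≡ pt v → part q u ≡ part q v
  pt⇒part e = trans (sym (toℕ-pt _)) (trans (cong toℕ e) (toℕ-pt _))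

  part⇒pt : {u : Fin m} {v : Fin n} → part q u ≡ part q v → pt u ≡ pt v
  part⇒pt e = Fin.toℕ-injective (trans (toℕ-pt _) (trans e (sym (toℕ-pt _))))

  vertex : (r b : ℕ) → .(r + b * q < n) → Fin n
  vertex r b lt = fromℕ< lt

  toℕ-vertex : ∀ r b .(lt : r + b * q < n) → toℕ (vertex r b lt) ≡ r + b * q
  toℕ-vertex r b lt = Fin.toℕ-fromℕ< lt

  part-vertex : ∀ {r} b .(lt : r + b * q < n) → r < q → part q (vertex r b lt) ≡ r
  part-vertex {r = r} b lt r<q = trans (cong (_% q) (toℕ-vertex r b lt)) ([r+bq]%q q b r<q)

  pt-vertex : (r : Fin q) → ∀ b .(lt : toℕ r + b * q < n) → pt (vertex (toℕ r) b lt) ≡ r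
  pt-vertex r b lt = Fin.toℕ-injective (trans (toℕ-pt (vertex (toℕ r) b lt)) (part-vertex b lt (Fin.toℕ<n r)))

  level-vertex : ∀ {r} b .(lt : r + b * q < n) → r < q → toℕ (vertex r b lt) / q ≡ b
  level-vertex {r = r} b lt r<q = trans (cong (_/ q) (toℕ-vertex r b lt)) ([r+bq]/q q b r<q)

  -- What types (I) and (II) have in common and the induction can carry. The monochromatic parts of
  -- type (I) are derived from it once all parts have two vertices.
  record Extremal (G : EdgeColoredGraph n) : Set where
    field
      is-complete : Complete G
      #colors     : c[ G ] ≡ t n q + 1
      turán       : RainbowCopy (T n q) G

  -- Pulling `G` back along the copy replaces vertices by their positions in `T n q`, so that the
  -- parts become residue classes. No vertex is lost, as an injection of `Fin n` into itself is
  -- onto.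
  module Positions (G : EdgeColoredGraph n) (is-complete : Complete G) (R : RainbowCopy (T n q) G) where
    open EdgeColoredGraph G hiding (m[_]; c[_])
    open RainbowCopy R public

    G′ : EdgeColoredGraph n
    G′ = pullback embed G

    private
      col : Fin n → Fin n → Color
      col i j = color (embed i) (embed j)

    complete′ : Complete G′
    complete′ u≢v = is-complete (u≢v ∘ injective)

    rainbow-pt : ∀ {i j k l} → pt i ≢ pt j → pt k ≢ pt l → col i j ≡ col k l → (i ≡ k × j ≡ l) ⊎ (i ≡ l × j ≡ k)
    rainbow-pt i≁j k≁l = rainbow (i≁j ∘ part⇒pt) (k≁l ∘ part⇒pt)

    surjective : ∀ v → ∃ λ i → embed i ≡ v
    surjective = injective⇒surjective injective

    open Multipartite G′ complete′ pt rainbow-pt public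

    private
      colPair : Fin n × Fin n → Color
      colPair = uncurry col

      T-edges = Graph.edges (T n q)
      oldColors = map colPair T-edges

      oldColors-unique : Unique oldColors
      oldColors-unique = unique-map (edges-unique (T n q)) inj
        where
        inj : ∀ {e f} → e ∈ T-edges → f ∈ T-edges → colPair e ≡ colPair f → e ≡ f
        inj e∈ f∈ eq with ∈edges⁻ (T n q) e∈ | ∈edges⁻ (T n q) f∈
        ... | e< , eT | f< , fT with rainbow eT fT eq
        ...   | inj₁ (refl , refl) = refl
        ...   | inj₂ (refl , refl) = contradiction e< (ℕ.<⇒≯ f<)

      ∈oldColors⁺ : ∀ {i j} → pt i ≢ pt j → col i j ∈ oldColors
      ∈oldColors⁺ {i} {j} i≁j with Fin.<-cmp i j
      ... | tri< i<j _ _ = ∈-map⁺ colPair (∈edges⁺ (T n q) i<j (i≁j ∘ part⇒pt))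
      ... | tri≈ _ refl _ = contradiction refl i≁j
      ... | tri> _ _ j<i = subst (_∈ oldColors) (color-sym _ _)
        (∈-map⁺ colPair (∈edges⁺ (T n q) j<i (i≁j ∘ sym ∘ part⇒pt)))

      ∈oldColors⁻ : ∀ {γ} → γ ∈ oldColors → ∃₂ λ i j → pt i ≢ pt j × γ ≡ col i j
      ∈oldColors⁻ γ∈ with (i , j) , e∈ , eq ← ∈-map⁻ colPair γ∈ =
        i , j , proj₂ (∈edges⁻ (T n q) e∈) ∘ pt⇒part , eq

      oldColors⊆ : ∀ {γ} → γ ∈ oldColors → γ ∈ colors G
      oldColors⊆ γ∈ with i , j , i≁j , refl ← ∈oldColors⁻ γ∈ =
        ∈colors⁺ G (complete′ {i} {j} (λ { refl → i≁j refl }))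

      open DecMembership _≟_ using (_∈?_)

    new-color : t n q < c[ G ] → ∃₂ λ z z′ → z ≢ z′ × pt z ≡ pt z′ × New (col z z′)
    new-color t<c with All.all? (_∈? oldColors) (colors G)
    ... | yes all-old = contradiction t<c (ℕ.≤⇒≯
      (subst (c[ G ] ≤_) (length-map colPair T-edges) (length-⊆ (colors-unique G) (All.lookup all-old))))
    ... | no ¬all-old with γ , γ∈ , γ∉ ← find (¬All⇒Any¬ (_∈? oldColors) (colors G) ¬all-old)
      with u , v , u<v , uv , refl ← ∈colors⁻ G γ∈
      with i , refl ← surjective u | j , refl ← surjective v with pt i Fin.≟ pt j
    ...   | yes i~j = i , j , (λ { refl → adj-irrefl uv }) , i~j ,
      λ a b a≁b e → γ∉ (subst (_∈ oldColors) e (∈oldColors⁺ a≁b))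
    ...   | no i≁j = contradiction (∈oldColors⁺ i≁j) γ∉

    -- The copy uses `t n q` colors and `zz′` one more; a further color on `pp′` would exceed the
    -- bound on `c[ G ]`.
    new-or-old : c[ G ] ≤ t n q + 1 → ∀ {z z′} → z ≢ z′ → New (col z z′) →
      ∀ {p p′} → p ≢ p′ → col p p′ ≡ col z z′ ⊎ (∃₂ λ x y → pt x ≢ pt y × col p p′ ≡ col x y)
    new-or-old c≤ {z} {z′} z≢z′ new {p} {p′} p≢p′ with col p p′ ∈? oldColors | col p p′ ≟ col z z′
    ... | yes old | _ = inj₂ (∈oldColors⁻ old)
    ... | no _ | yes e = inj₁ e
    ... | no ¬old | no ¬e = contradiction c≤ (ℕ.<⇒≱ (subst (_≤ c[ G ])
      (cong suc (trans (cong suc (length-map colPair T-edges)) (ℕ.+-comm 1 (t n q))))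
      (length-⊆ (All.tabulate fresh₁ ∷ All.tabulate fresh₂ ∷ oldColors-unique) sub)))
      where
      fresh₂ : ∀ {γ} → γ ∈ oldColors → col z z′ ≢ γ
      fresh₂ γ∈ e with a , b , a≁b , refl ← ∈oldColors⁻ γ∈ = new a b a≁b (sym e)
      fresh₁ : ∀ {γ} → γ ∈ col z z′ ∷ oldColors → col p p′ ≢ γ
      fresh₁ (here refl) = ¬e
      fresh₁ (there γ∈) refl = ¬old γ∈
      sub : ∀ {γ} → γ ∈ col p p′ ∷ col z z′ ∷ oldColors → γ ∈ colors G
      sub (here refl) = ∈colors⁺ G (complete′ p≢p′)
      sub (there (here refl)) = ∈colors⁺ G (complete′ z≢z′)
      sub (there (there γ∈)) = oldColors⊆ γ∈

    module _ (4≤q : 4 ≤ q) (2≤n/q : 2 ≤ n / q) (c≡ : c[ G ] ≡ t n q + 1)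
             (no-copy : ¬ RainbowCopy (K (2 + q)) G) where

      private
        two : ∀ r → ∃₂ λ (a b : Fin n) → a ≢ b × pt a ≡ r × pt b ≡ r
        two r = vertex (toℕ r) 0 lt₀ , vertex (toℕ r) 1 lt₁
              , (λ e → ℕ.0≢1+n (trans (sym (level-vertex 0 lt₀ (Fin.toℕ<n r)))
                  (trans (cong (λ v → toℕ v / q) e) (level-vertex 1 lt₁ (Fin.toℕ<n r)))))
              , pt-vertex r 0 lt₀ , pt-vertex r 1 lt₁
          where
          lt₀ : toℕ r + 0 * q < n
          lt₀ = r+bq<n q (Fin.toℕ<n r) (ℕ.<-trans (s≤s z≤n) 2≤n/q)
          lt₁ : toℕ r + 1 * q < n
          lt₁ = r+bq<n q (Fin.toℕ<n r) 2≤n/q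

      monochromatic : ∃ λ α → New α × (∀ {p p′} → p ≢ p′ → pt p ≡ pt p′ → col p p′ ≡ α)
      monochromatic
        with z , z′ , z≢z′ , zz′ , new ← new-color (ℕ.≤-reflexive (trans (ℕ.+-comm 1 _) (sym c≡))) =
        col z z′ , new , inside-monochromatic (no-copy ∘ pullback-copy injective) two 4≤q z≢z′ zz′ new
          (λ p≢p′ _ → new-or-old (ℕ.≤-reflexive c≡) z≢z′ new p≢p′)

    module _ {α : Color} (new : New α) (inside : ∀ {p p′} → p ≢ p′ → pt p ≡ pt p′ → col p p′ ≡ α) where

      private
        pos : Fin n → Fin n
        pos v = proj₁ (surjective v)
        embed-pos : ∀ v → embed (pos v) ≡ v
        embed-pos v = proj₂ (surjective v)
        pos-injective : ∀ {u v} → pos u ≡ pos v → u ≡ v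
        pos-injective e = trans (sym (embed-pos _)) (trans (cong embed e) (embed-pos _))

        col-pos : ∀ u v → col (pos u) (pos v) ≡ color u v
        col-pos u v = cong₂ color (embed-pos u) (embed-pos v)

        Found : Color → Set
        Found γ = ∃₂ λ i j → i F.< j × part q i ≢ part q j × col i j ≡ γ

        search : ∀ γ → Dec (Found γ)
        search γ = Fin.any? λ i → Fin.any? λ j →
          (i <? j) ×-dec ¬? (part q i ℕ.≟ part q j) ×-dec (col i j ≟ γ)

        found : ∀ {i j} → part q i ≢ part q j → Found (col i j)
        found {i} {j} i≁j with Fin.<-cmp i j
        ... | tri< i<j _ _ = i , j , i<j , i≁j , refl
        ... | tri≈ _ refl _ = contradiction refl i≁j
        ... | tri> _ _ j<i = j , i , j<i , i≁j ∘ sym , color-sym _ _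

        -- Colors are abstract, so the endpoints that name a color in `H` are recovered by a finite
        -- search. On cross colors the pair found is unique by rainbowness; the default `nothing` is
        -- the color inside the parts.
        rename : Color → Maybe (ℕ × ℕ)
        rename γ with search γ
        ... | yes (i , j , _) = just (toℕ i , toℕ j)
        ... | no _ = nothing

        rename-col : ∀ i j → i ≢ j → rename (col i j) ≡ colorH q i j
        rename-col i j i≢j with part q i ℕ.≟ part q j | search (col i j)
        ... | yes i~j | yes (k , l , _ , k≁l , e) =
          contradiction (trans e (inside i≢j (part⇒pt i~j))) (new k l (k≁l ∘ pt⇒part))
        ... | yes _ | no _ = refl
        ... | no i≁j | no ¬found = contradiction (found i≁j) ¬found
        ... | no i≁j | yes (k , l , k<l , k≁l , e) with rainbow k≁l i≁j e
        ...   | inj₁ (refl , refl) = cong just (cong₂ _,_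
          (sym (ℕ.m≤n⇒m⊓n≡m (ℕ.<⇒≤ k<l))) (sym (ℕ.m≤n⇒m⊔n≡n (ℕ.<⇒≤ k<l))))
        ...   | inj₂ (refl , refl) = cong just (cong₂ _,_
          (sym (ℕ.m≥n⇒m⊓n≡n (ℕ.<⇒≤ k<l))) (sym (ℕ.m≥n⇒m⊔n≡m (ℕ.<⇒≤ k<l))))

        rename-color : ∀ u v → u ≢ v → rename (color u v) ≡ colorH q (pos u) (pos v)
        rename-color u v u≢v = trans (cong rename (sym (col-pos u v)))
          (rename-col (pos u) (pos v) (u≢v ∘ pos-injective))

        unfound : ∀ {u v} → Adj u v → ¬ Found (color u v) → color u v ≡ α
        unfound {u} {v} uv ¬found with part q (pos u) ℕ.≟ part q (pos v)
        ... | yes e = trans (sym (col-pos u v)) (inside (Adj⇒≢ graph uv ∘ pos-injective) (part⇒pt e))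
        ... | no ≁ = contradiction (subst Found (col-pos u v) (found ≁)) ¬found

        rename-injective : ∀ {u v x y} → Adj u v → Adj x y →
          rename (color u v) ≡ rename (color x y) → color u v ≡ color x y
        rename-injective {u} {v} {x} {y} uv xy e with search (color u v) | search (color x y)
        ... | no ¬f | no ¬f′ = trans (unfound uv ¬f) (sym (unfound xy ¬f′))
        ... | yes (_ , _ , _ , _ , e₁) | yes (_ , _ , _ , _ , e₂)
          with a , b ← ,-injective (just-injective e)
          with refl ← Fin.toℕ-injective a | refl ← Fin.toℕ-injective b = trans (sym e₁) e₂

      turán-iso : G ≅ H n q
      turán-iso = record
        { σ = permutation pos embed (λ i → injective (embed-pos (embed i))) embed-pos
        ; adj⇔ = λ u v → mk⇔ (λ uv e → Adj⇒≢ graph uv (pos-injective e)) (λ u≢v → is-complete (u≢v ∘ cong pos))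
        ; rename = rename
        ; rename-inj = λ uv xy e → rename-injective uv xy e
        ; color-≡ = λ {u} {v} uv → sym (rename-color u v (Adj⇒≢ graph uv))
        }

-- Adding a vertex to a rainbow Turán graph

-- Here `l` counts the lost colors, `a` is `n / q` and `b` the number of pairs of vertices. The
-- upper bound on `c` comes from the color count before `v` is added and the limit on `l`; the lower
-- one holds as at most `b` of `m + c` are edges.
c-arith : ∀ {c c′ l a n t t′ b m} → c ≤ c′ + l → c′ ≡ t + 1 → l + a ≤ n → t′ + a ≡ t + n →
  b + t′ + 1 ≤ m + c → m ≤ b → c ≡ t′ + 1
c-arith {c} {c′} {l} {a} {n} {t} {t′} {b} {m} c≤ c′≡ l≤ t≡ b≤ m≤ = ℕ.≤-antisym
  (ℕ.+-cancelʳ-≤ a c (t′ + 1) (begin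
    c + a            ≤⟨ ℕ.+-monoˡ-≤ a c≤ ⟩
    c′ + l + a       ≡⟨ ℕ.+-assoc c′ l a ⟩
    c′ + (l + a)     ≤⟨ ℕ.+-mono-≤ (ℕ.≤-reflexive c′≡) l≤ ⟩
    t + 1 + n        ≡⟨ shuffle t n ⟩
    t + n + 1        ≡⟨ cong (_+ 1) (sym t≡) ⟩
    t′ + a + 1       ≡⟨ sym (shuffle t′ a) ⟩
    t′ + 1 + a       ∎))
  (ℕ.+-cancelˡ-≤ b (t′ + 1) c (ℕ.≤-trans (ℕ.≤-reflexive (sym (ℕ.+-assoc b t′ 1)))
    (ℕ.≤-trans b≤ (ℕ.+-monoˡ-≤ c m≤))))
  where
  open ℕ.≤-Reasoning
  shuffle : ∀ x y → x + 1 + y ≡ x + y + 1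
  shuffle = solve-∀

module _ (q : ℕ) .{{_ : NonZero q}} where

  private
    swap : ℕ → ℕ → ℕ → ℕ
    swap r s x with x ℕ.≟ r | x ℕ.≟ s
    ... | yes _ | _ = s
    ... | no _ | yes _ = r
    ... | no _ | no _ = x

    swap-fst : ∀ r s → swap r s r ≡ s
    swap-fst r s with r ℕ.≟ r
    ... | yes _ = refl
    ... | no ¬e = contradiction refl ¬e

    swap-snd : ∀ r s → swap r s s ≡ r
    swap-snd r s with s ℕ.≟ r | s ℕ.≟ s
    ... | yes e | _ = e
    ... | no _ | yes _ = refl
    ... | no _ | no ¬e = contradiction refl ¬e

    swap-other : ∀ {r s x} → x ≢ r → x ≢ s → swap r s x ≡ x
    swap-other {r} {s} {x} x≢r x≢s with x ℕ.≟ r | x ℕ.≟ s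
    ... | yes e | _ = contradiction e x≢r
    ... | no _ | yes e = contradiction e x≢s
    ... | no _ | no _ = refl

    swap-involutive : ∀ r s x → swap r s (swap r s x) ≡ x
    swap-involutive r s x with x ℕ.≟ r | x ℕ.≟ s
    ... | yes e | _ = trans (swap-snd r s) (sym e)
    ... | no _ | yes e = trans (swap-fst r s) (sym e)
    ... | no x≢r | no x≢s = swap-other x≢r x≢s

    swap-injective : ∀ r s {x y} → swap r s x ≡ swap r s y → x ≡ y
    swap-injective r s e = trans (sym (swap-involutive r s _)) (trans (cong (swap r s) e) (swap-involutive r s _))

    swap-< : ∀ {r s x} → r < q → s < q → x < q → swap r s x < q
    swap-< {r} {s} {x} r< s< x< with x ℕ.≟ r | x ℕ.≟ s
    ... | yes _ | _ = s<
    ... | no _ | yes _ = r<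
    ... | no _ | no _ = x<

  -- The residue classes r and n % q can be exchanged because, for r ≥ n % q, both
  -- have ⌊n/q⌋ elements below n.
  module SwapClasses (n : ℕ) {r : ℕ} (r<q : r < q) (n%q≤r : n % q ≤ r) where
    private
      sw : ℕ → ℕ
      sw = swap r (n % q)

      -- Levels are kept. An index of residue at least `n % q` has level below `n / q`, where every
      -- residue fits; a smaller residue is neither `r` nor `n % q` and stays fixed.
      bound : (i : Fin n) → sw (part q i) + toℕ i / q * q < n
      bound i with n % q ℕ.≤? part q i
      ... | yes ≤part = r+bq<n q (swap-< r<q (m%n<n n q) (m%n<n (toℕ i) q)) (/-<-/ q (Fin.toℕ<n i) ≤part)
      ... | no ≰part = subst (_< n) (trans (m≡m%n+[m/n]*n (toℕ i) q) (cong (_+ toℕ i / q * q)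
          (sym (swap-other (λ e → ≰part (subst (n % q ≤_) (sym e) n%q≤r)) (λ e → ≰part (ℕ.≤-reflexive (sym e)))))))
          (Fin.toℕ<n i)

    ψ : Fin n → Fin n
    ψ i = fromℕ< (bound i)

    private
      part-ψ : ∀ i → part q (ψ i) ≡ sw (part q i)
      part-ψ i = trans (cong (_% q) (Fin.toℕ-fromℕ< (bound i)))
        ([r+bq]%q q (toℕ i / q) (swap-< r<q (m%n<n n q) (m%n<n (toℕ i) q)))

      level-ψ : ∀ i → toℕ (ψ i) / q ≡ toℕ i / q
      level-ψ i = trans (cong (_/ q) (Fin.toℕ-fromℕ< (bound i)))
        ([r+bq]/q q (toℕ i / q) (swap-< r<q (m%n<n n q) (m%n<n (toℕ i) q)))

    ψ-cross : ∀ {i j} → part q (ψ i) ≡ part q (ψ j) → part q i ≡ part q j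
    ψ-cross {i} {j} e = swap-injective r (n % q) (trans (sym (part-ψ i)) (trans e (part-ψ j)))

    ψ-injective : ∀ {i j} → ψ i ≡ ψ j → i ≡ j
    ψ-injective {i} {j} e = part-injective q (ψ-cross (cong (part q) e))
      (trans (sym (level-ψ i)) (trans (cong (λ k → toℕ k / q) e) (level-ψ j)))

    ψ-class : ∀ {i} → part q (ψ i) ≡ r → part q i ≡ n % q
    ψ-class {i} e = swap-injective r (n % q) (trans (sym (part-ψ i)) (trans e (sym (swap-snd r (n % q)))))

  module _ (G : EdgeColoredGraph (suc n)) (v : Fin (suc n)) where
    open EdgeColoredGraph G hiding (m[_]; c[_])

    private
      D = del v G
      open DecMembership _≟_ using (_∉?_)

      to : Fin n → Fin (suc n)
      to = punchIn v

      Lost : Fin n → Set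
      Lost w = Adj v (to w) × color v (to w) ∉ colors D

      Witness : Color → Fin n → Set
      Witness γ w = Adj v (to w) × color v (to w) ≡ γ

      witness? : ∀ γ → Dec (∃ (Witness γ))
      witness? γ = Fin.any? λ w → adj? v (to w) ×-dec (color v (to w) ≟ γ)

      first : Color → Maybe (Fin n)
      first γ with witness? γ
      ... | yes (w , _) = just w
      ... | no _ = nothing

      first-just : ∀ {w} → Adj v (to w) →
        ∃ λ w′ → Witness (color v (to w)) w′ × first (color v (to w)) ≡ just w′
      first-just {w} vw with witness? (color v (to w))
      ... | yes (w′ , p) = w′ , p , refl
      ... | no ∄ = contradiction (w , vw , refl) ∄

    -- As `first` depends on the color only, a lost color has one representative.
    Rep : Fin n → Set
    Rep w = Lost w × first (color v (to w)) ≡ just w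

    rep? : Decidable Rep
    rep? w = (adj? v (to w) ×-dec (color v (to w) ∉? colors D))
      ×-dec Maybe.≡-dec Fin._≟_ (first (color v (to w))) (just w)

    rep-injective : ∀ {w w′} → Rep w → Rep w′ → color v (to w) ≡ color v (to w′) → w ≡ w′
    rep-injective (_ , f) (_ , f′) e = just-injective (trans (sym f) (trans (cong first e) f′))

    represented : ∀ {w} → Lost w → ∃ λ w′ → Rep w′ × color v (to w) ≡ color v (to w′)
    represented {w} (vw , lost) with w′ , (vw′ , e) , f ← first-just vw =
      w′ , ((vw′ , subst (_∉ colors D) (sym e) lost) , trans (cong first e) f) , sym e

    -- A lost color occurs only on edges at `v`, hence on a representing one. The surjection `e`
    -- allows the count to be made over positions in a Turán copy.
    lostColors≤reps : {e : Fin n → Fin n} → (∀ w → ∃ λ i → e i ≡ w) → lostColors G v ≤ # (rep? ∘ e)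
    lostColors≤reps {e} surj = subst (lostColors G v ≤_) (length-map vcol (filter (rep? ∘ e) (allFin n)))
      (length-⊆ (Unique.filter⁺ (_∉? colors D) (colors-unique G)) cover)
      where
      vcol : Fin n → Color
      vcol i = color v (to (e i))
      lost⇒ : ∀ {u w} → Adj u w → color u w ∉ colors D → ∃ λ x → Lost x × color u w ≡ color v (to x)
      lost⇒ {u} {w} uw lost with lost-color-incident G uw lost
      ... | inj₁ refl with x , refl ← punchIn-surjective (Adj⇒≢ graph uw ∘ sym) = x , (uw , lost) , refl
      ... | inj₂ refl with x , refl ← punchIn-surjective (Adj⇒≢ graph uw) =
        x , (adj-sym uw , subst (_∉ colors D) (color-sym _ _) lost) , color-sym _ _
      cover : ∀ {γ} → γ ∈ filter (_∉? colors D) (colors G) → γ ∈ map vcol (filter (rep? ∘ e) (allFin n))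
      cover γ∈ with γ∈G , lost ← ∈-filter⁻ (_∉? colors D) {xs = colors G} γ∈
        with u , w , _ , uw , refl ← ∈colors⁻ G γ∈G
        with x , lost-x , e₁ ← lost⇒ uw lost
        with x′ , rep , e₂ ← represented lost-x
        with i , refl ← surj x′ =
        subst (_∈ map vcol (filter (rep? ∘ e) (allFin n))) (sym (trans e₁ e₂)) (∈-map⁺ vcol (∈#⁺ (rep? ∘ e) rep))

    -- Representing edges have pairwise different colors that do not occur in `D`, so `v` can be
    -- joined to any rainbow clique spanned by their ends.
    rep-copy : {e : Fin n → Fin n} → Injective _≡_ _≡_ e → (c : RainbowCopy (K s) (pullback e D)) →
      (∀ i → Rep (e (RainbowCopy.embed c i))) → RainbowCopy (K (suc s)) G
    rep-copy {e = e} e-inj c reps = addVertex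
      (pullback-copy {ι = to} (Fin.punchIn-injective v _ _) (pullback-copy {ι = e} e-inj c)) v
      (λ i → proj₁ (proj₁ (reps i)))
      (λ eq → injective (e-inj (rep-injective (reps _) (reps _) eq)))
      (λ j≢k eq → proj₂ (proj₁ (reps _)) (subst (_∈ colors D) (sym eq) (∈colors⁺ D (preserves j≢k))))
      where open RainbowCopy c

    module _ (complete : Complete G) (R : RainbowCopy (T n q) D) {r : ℕ} (r<q : r < q) (n%q≤r : n % q ≤ r)
             (outside : ∀ i → part q i ≢ r → Rep (RainbowCopy.embed R i)) where
      open RainbowCopy R

      private
        open SwapClasses n r<q n%q≤r

        f : {u : Fin (suc n)} → View u → Fin (suc n)
        f ‵fromℕ = v
        f (‵inject₁ j) = to (embed (ψ j))

        f-injective : ∀ {u w} (vu : View u) (vw : View w) → f vu ≡ f vw → u ≡ w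
        f-injective ‵fromℕ ‵fromℕ _ = refl
        f-injective ‵fromℕ (‵inject₁ j) e = contradiction (sym e) (Fin.punchInᵢ≢i v _)
        f-injective (‵inject₁ i) ‵fromℕ e = contradiction e (Fin.punchInᵢ≢i v _)
        f-injective (‵inject₁ i) (‵inject₁ j) e =
          cong inject₁ (ψ-injective (injective (Fin.punchIn-injective v _ _ e)))

        embed′ : Fin (suc n) → Fin (suc n)
        embed′ u = f (view u)

        ψ-cross′ : ∀ {i j : Fin n} → part q (inject₁ i) ≢ part q (inject₁ j) → part q (ψ i) ≢ part q (ψ j)
        ψ-cross′ {i} {j} i≁j e = i≁j (trans (cong (_% q) (Fin.toℕ-inject₁ i))
          (trans (ψ-cross e) (cong (_% q) (sym (Fin.toℕ-inject₁ j)))))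

        rep-ψ : ∀ {i : Fin n} → part q (inject₁ i) ≢ part q (fromℕ n) → Rep (embed (ψ i))
        rep-ψ {i} i≁n = outside (ψ i) λ e → i≁n (trans (cong (_% q) (Fin.toℕ-inject₁ i))
          (trans (ψ-class e) (cong (_% q) (sym (Fin.toℕ-fromℕ n)))))

        inside-D : ∀ {i j} → part q (ψ i) ≢ part q (ψ j) → color (to (embed (ψ i))) (to (embed (ψ j))) ∈ colors D
        inside-D i≁j = ∈colors⁺ D (preserves i≁j)

        f-rainbow : ∀ {u w x y} (vu : View u) (vw : View w) (vx : View x) (vy : View y) → u F.< w → x F.< y →
          part q u ≢ part q w → part q x ≢ part q y →
          color (f vu) (f vw) ≡ color (f vx) (f vy) → u ≡ x × w ≡ y
        f-rainbow {w = w} ‵fromℕ _ _ _ u<w _ _ _ _ = contradiction u<w (ℕ.≤⇒≯ (Fin.≤fromℕ w))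
        f-rainbow {y = y} (‵inject₁ i) _ ‵fromℕ _ _ x<y _ _ _ = contradiction x<y (ℕ.≤⇒≯ (Fin.≤fromℕ y))
        f-rainbow (‵inject₁ i) ‵fromℕ (‵inject₁ k) ‵fromℕ _ _ uw xy e =
          cong inject₁ (ψ-injective (injective (rep-injective (rep-ψ uw) (rep-ψ xy)
            (trans (color-sym _ _) (trans e (color-sym _ _)))))) , refl
        f-rainbow (‵inject₁ i) ‵fromℕ (‵inject₁ k) (‵inject₁ l) _ _ uw xy e =
          contradiction (subst (_∈ colors D) (sym (trans (color-sym _ _) e)) (inside-D (ψ-cross′ xy)))
            (proj₂ (proj₁ (rep-ψ uw)))
        f-rainbow (‵inject₁ i) (‵inject₁ j) (‵inject₁ k) ‵fromℕ _ _ uw xy e =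
          contradiction (subst (_∈ colors D) (trans e (color-sym _ _)) (inside-D (ψ-cross′ uw)))
            (proj₂ (proj₁ (rep-ψ xy)))
        f-rainbow (‵inject₁ i) (‵inject₁ j) (‵inject₁ k) (‵inject₁ l) u<w x<y uw xy e
          with rainbow (ψ-cross′ uw) (ψ-cross′ xy) e
        ... | inj₁ (a , b) = cong inject₁ (ψ-injective a) , cong inject₁ (ψ-injective b)
        ... | inj₂ (a , b) with refl ← ψ-injective a | refl ← ψ-injective b =
          contradiction u<w (ℕ.<⇒≯ x<y)

      -- `v` plays the last vertex, whose residue is `n % q`, whereas the class without assumed
      -- representatives is `r`; `ψ` exchanges the two classes. Cross edges at `v` then have
      -- distinct lost colors.
      extend-turán : RainbowCopy (T (suc n) q) G
      extend-turán = record
        { embed = embed′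
        ; injective = λ {u} {w} → f-injective (view u) (view w)
        ; preserves = λ {u} {w} uw → complete (λ e → uw (cong (part q) (f-injective (view u) (view w) e)))
        ; rainbow = rainbow-ordered (T (suc n) q) G embed′
            (λ {u} {w} {x} {y} u<w x<y uw xy e → f-rainbow (view u) (view w) (view x) (view y) u<w x<y uw xy e)
        }

    module _ (complete-D : Complete D) (cD : c[ D ] ≡ t n q + 1)
             (m+c≥ : suc n C 2 + t (suc n) q + 1 ≤ m[ G ] + c[ G ])
             (losses : n + n ≤ lostEdges G v + (lostColors G v + n / q)) where

      complete-del : n ≤ lostEdges G v → Complete G
      complete-del lost≥ {u} {w} u≢w = by-cases (v Fin.≟ u) (v Fin.≟ w)
        where
        at-v : ∀ {w} → v ≢ w → Adj v w
        at-v = lostEdges≥n⇒Adj G v lost≥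
        by-cases : Dec (v ≡ u) → Dec (v ≡ w) → Adj u w
        by-cases (yes refl) _ = at-v u≢w
        by-cases (no _) (yes refl) = adj-sym (at-v (u≢w ∘ sym))
        by-cases (no v≢u) (no v≢w) =
          let i , eᵢ = punchIn-surjective (v≢u ∘ sym)
              j , eⱼ = punchIn-surjective (v≢w ∘ sym)
          in subst₂ Adj eᵢ eⱼ (complete-D (λ i≡j → u≢w (trans (sym eᵢ) (trans (cong to i≡j) eⱼ))))

      c≡-del : lostColors G v + n / q ≤ n → c[ G ] ≡ t (suc n) q + 1
      c≡-del lost≤ = c-arith {c[ G ]} {c[ D ]} {lostColors G v} {n / q} {n} {t n q} {t (suc n) q}
        {suc n C 2} {m[ G ]} (c≤c-del G v) cD lost≤ (t-suc q n) m+c≥ (m≤C2 G)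

      -- At most `n` edges are lost with `v`, so `losses` leaves at least `n - n / q` lost colors.
      reps≥ : {e : Fin n → Fin n} → (∀ w → ∃ λ i → e i ≡ w) → n ≤ # (rep? ∘ e) + n / q
      reps≥ surj = ℕ.≤-trans
        (ℕ.+-cancelˡ-≤ n n (lostColors G v + n / q)
          (ℕ.≤-trans losses (ℕ.+-monoˡ-≤ (lostColors G v + n / q) (lostEdges≤n G v))))
        (ℕ.+-monoˡ-≤ (n / q) (lostColors≤reps surj))

      module _ (R : RainbowCopy (T n q) D) {r : ℕ} (r<q : r < q)
               (class-free : ∀ i → part q i ≡ r → ¬ Rep (RainbowCopy.embed R i)) where
        open RainbowCopy R

        private
          surj : ∀ w → ∃ λ i → embed i ≡ w
          surj = injective⇒surjective injective

          disjoint : ∀ {i} → Rep (embed i) → ¬ part q i ≡ r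
          disjoint rep e = class-free _ e rep

          reps class : ℕ
          reps = # (rep? ∘ embed)
          class = # (class? q {n} r)

          outside : ∀ i → part q i ≢ r → Rep (embed i)
          outside i = #-cover (rep? ∘ embed) (class? q r) disjoint
            (ℕ.≤-trans (reps≥ surj) (ℕ.+-monoʳ-≤ reps (n/q≤#class q r<q)))

          reps+class≤n : reps + class ≤ n
          reps+class≤n = #-disjoint (rep? ∘ embed) (class? q r) disjoint

          n%q≤r : n % q ≤ r
          n%q≤r = ℕ.≮⇒≥ λ r< → ℕ.<⇒≱ (ℕ.≤-trans (ℕ.+-monoʳ-< reps (n/q<#class q r<)) reps+class≤n) (reps≥ surj)

          lostColors≤ : lostColors G v + n / q ≤ n
          lostColors≤ = ℕ.≤-trans (ℕ.+-mono-≤ (lostColors≤reps surj) (n/q≤#class q r<q)) reps+class≤n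

          lostEdges≥ : n ≤ lostEdges G v
          lostEdges≥ = ℕ.+-cancelʳ-≤ n n (lostEdges G v)
            (ℕ.≤-trans losses (ℕ.+-monoʳ-≤ (lostEdges G v) lostColors≤))

        -- The chain `n ≤ reps + n / q ≤ reps + class ≤ n` consists of equalities. Hence the class
        -- is a smallest one, every vertex outside it is a representative, and `v` loses `n` edges,
        -- so it is adjacent to all other vertices.
        extend-class : Extremal q G
        extend-class = record
          { is-complete = complete-del lostEdges≥
          ; #colors = c≡-del lostColors≤
          ; turán = extend-turán (complete-del lostEdges≥) R r<q n%q≤r outside
          }

-- Primes refer to the larger graph. The smaller one has at most `b` edges and exactly `t + 1`
-- colors, so the growth of the threshold, `n` for the edges and `n - a` for the Turán number, must
-- be made up by what is lost with `v`.
loss-arith : ∀ {m c m′ c′ lE lC b b′ n t t′ a} → m ≤ b → c ≡ t + 1 → b′ ≡ b + n → t′ + a ≡ t + n →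
  m′ ≤ m + lE → c′ ≤ c + lC → b′ + t′ + 1 ≤ m′ + c′ → n + n ≤ lE + (lC + a)
loss-arith {m} {_} {m′} {c′} {lE} {lC} {b} {_} {n} {t} {t′} {a} m≤ refl refl t≡ m′≤ c′≤ b≤ =
  ℕ.+-cancelˡ-≤ (b + t + 1) (n + n) (lE + (lC + a)) (begin
    b + t + 1 + (n + n)                ≡⟨ e₁ b t n ⟩
    b + n + (t + n) + 1                ≡⟨ cong (λ x → b + n + x + 1) (sym t≡) ⟩
    b + n + (t′ + a) + 1               ≡⟨ e₂ (b + n) t′ a ⟩
    b + n + t′ + 1 + a                 ≤⟨ ℕ.+-monoˡ-≤ a b≤ ⟩
    m′ + c′ + a                        ≤⟨ ℕ.+-monoˡ-≤ a (ℕ.+-mono-≤ m′≤ c′≤) ⟩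
    m + lE + (t + 1 + lC) + a          ≤⟨ ℕ.+-monoˡ-≤ a (ℕ.+-monoˡ-≤ (t + 1 + lC) (ℕ.+-monoˡ-≤ lE m≤)) ⟩
    b + lE + (t + 1 + lC) + a          ≡⟨ e₃ b lE t lC a ⟩
    b + t + 1 + (lE + (lC + a))        ∎)
  where
  open ℕ.≤-Reasoning
  e₁ : ∀ b t n → b + t + 1 + (n + n) ≡ b + n + (t + n) + 1
  e₁ = solve-∀
  e₂ : ∀ x t a → x + (t + a) + 1 ≡ x + t + 1 + a
  e₂ = solve-∀
  e₃ : ∀ b x t y a → b + x + (t + 1 + y) + a ≡ b + t + 1 + (x + (y + a))
  e₃ = solve-∀

descent-arith : ∀ {m c m′ c′ lE lC y} → lE + lC + y < m′ + c′ → m′ ≤ m + lE → c′ ≤ c + lC → y + 1 ≤ m + c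
descent-arith {m} {c} {m′} {c′} {lE} {lC} {y} lt m′≤ c′≤ =
  ℕ.+-cancelˡ-≤ (lE + lC) (y + 1) (m + c) (begin
    lE + lC + (y + 1)    ≡⟨ e₁ lE lC y ⟩
    suc (lE + lC + y)    ≤⟨ lt ⟩
    m′ + c′              ≤⟨ ℕ.+-mono-≤ m′≤ c′≤ ⟩
    m + lE + (c + lC)    ≡⟨ e₂ m lE c lC ⟩
    lE + lC + (m + c)    ∎)
  where
  open ℕ.≤-Reasoning
  e₁ : ∀ x z y → x + z + (y + 1) ≡ suc (x + z + y)
  e₁ = solve-∀
  e₂ : ∀ m x c z → m + x + (c + z) ≡ x + z + (m + c)
  e₂ = solve-∀

-- Used with `a = n / q`: as `a * q ≤ n`, the representatives, at least `n - a` in number, outnumber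
-- the `q` parts.
product-arith : ∀ {a q} → 2 ≤ a → 4 ≤ q → q + a < a * q
product-arith {suc (suc a)} {suc (suc (suc (suc q)))} (s≤s (s≤s z≤n)) (s≤s (s≤s (s≤s (s≤s z≤n)))) =
  subst (4 + q + (2 + a) <_) (e a q) (ℕ.m≤m+n (suc (4 + q + (2 + a))) (1 + q + 3 * a + a * q))
  where
  e : ∀ a q → suc (4 + q + (2 + a)) + (1 + q + 3 * a + a * q) ≡ (2 + a) * (4 + q)
  e = solve-∀

-- Placing the deleted vertex

module _ (q : ℕ) .{{_ : NonZero q}} (4≤q : 4 ≤ q) where

  private
    singleton? : (u : Fin n) → Decidable (_≡ u)
    singleton? u i = i Fin.≟ u

    1≤#singleton : (u : Fin n) → 1 ≤ # (singleton? u)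
    1≤#singleton u = ∈-length (∈#⁺ (singleton? u) refl)

  module Step (G : EdgeColoredGraph (suc n)) (v : Fin (suc n)) (1≤n/q : 1 ≤ n / q)
              (ext : Extremal q (del v G)) (no-copy : ¬ RainbowCopy (K (2 + q)) G)
              (m+c≥ : suc n C 2 + t (suc n) q + 1 ≤ m[ G ] + c[ G ])
              (losses : n + n ≤ lostEdges G v + (lostColors G v + n / q)) where
    open Extremal ext

    private
      R = Rep q G v
      r? = rep? q G v

      extend : (copy : RainbowCopy (T n q) (del v G)) (r : Fin q) →
               (∀ i → pt q i ≡ r → ¬ R (RainbowCopy.embed copy i)) → Extremal q G
      extend copy r free = extend-class q G v is-complete #colors m+c≥ losses copy (Fin.toℕ<n r)
        λ i e → free i (Fin.toℕ-injective (trans (toℕ-pt q i) e))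

    open Positions q (del v G) is-complete turán

    private
      col : Fin n → Fin n → EdgeColoredGraph.Color G
      col = EdgeColoredGraph.color G′

      no-copy′ : ¬ RainbowCopy (K (2 + q)) (del v G)
      no-copy′ = no-copy ∘ pullback-copy (Fin.punchIn-injective v _ _)

      R′ : Fin n → Set
      R′ i = R (embed i)

      reps : ℕ
      reps = # (r? ∘ embed)

      n≤reps : n ≤ reps + n / q
      n≤reps = reps≥ q G v is-complete #colors m+c≥ losses surjective

      twin-contradiction : (S : Transversal) (x : Fin n) → R′ x → (∀ r → R′ (proj₁ S r)) →
        x ≢ proj₁ S (pt q x) → ¬ New (col x (proj₁ S (pt q x)))
      twin-contradiction S x Rx RS x≢ new = no-copy (rep-copy q G v injective
        (twin-copy-new S x x≢ new) λ { zero → Rx ; (suc r) → RS r })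

    -- If every part had a representative, there would be a transversal of them and, by their
    -- number, one more. By `monochromatic` its twin edge has the new color whichever part it lies
    -- in.
    large : 2 ≤ n / q → Extremal q G
    large 2≤n/q = by-cases (Fin.all? hit?)
      where
      Hit : Fin q → Set
      Hit r = ∃ λ i → pt q i ≡ r × R′ i
      hit? : Decidable Hit
      hit? r = Fin.any? λ i → (pt q i Fin.≟ r) ×-dec r? (embed i)
      by-cases : Dec (∀ r → Hit r) → Extremal q G
      by-cases (no ¬all) = let r , ¬hit = Fin.¬∀⟶∃¬ q Hit hit? ¬all in
        extend turán r λ i e Ri → ¬hit (i , e , Ri)
      by-cases (yes hits) = no-second (Fin.any? second?)
        where
        S : Transversal
        S = (λ r → proj₁ (hits r)) , (λ r → proj₁ (proj₂ (hits r)))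
        τ : Fin q → Fin n
        τ = proj₁ S
        Second : Fin n → Set
        Second w = R′ w × w ≢ τ (pt q w)
        second? : Decidable Second
        second? w = r? (embed w) ×-dec ¬? (w Fin.≟ τ (pt q w))
        mono = monochromatic 4≤q 2≤n/q #colors no-copy′
        α-new = proj₁ (proj₂ mono)
        inside = proj₂ (proj₂ mono)
        no-second : Dec (∃ Second) → Extremal q G
        no-second (yes (w , Rw , w≢)) = contradiction
          (subst New (sym (inside w≢ (sym (proj₂ S (pt q w))))) α-new)
          (twin-contradiction S w Rw (λ r → proj₂ (proj₂ (hits r))) w≢)
        no-second (no ∄) = contradiction (ℕ.≤-trans n≤reps (ℕ.+-monoˡ-≤ (n / q) reps≤q))
          (ℕ.<⇒≱ (ℕ.<-≤-trans (product-arith 2≤n/q 4≤q) (m/n*n≤m n q)))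
          where
          covered : ∀ {w} → w ∈ filter (r? ∘ embed) (allFin n) → w ∈ map τ (allFin q)
          covered {w} w∈ = subst (_∈ map τ (allFin q))
            (sym (decidable-stable (w Fin.≟ τ (pt q w)) (λ w≢ → ∄ (w , ∈#⁻ (r? ∘ embed) w∈ , w≢))))
            (∈-map⁺ τ (∈-allFin (pt q w)))
          reps≤q : reps ≤ q
          reps≤q = subst (reps ≤_) (trans (length-map τ (allFin q)) (length-allFin q))
            (length-⊆ (#-unique (r? ∘ embed)) covered)

    module Small (n/q≡1 : n / q ≡ 1) where

      private
        base : Transversal
        base = (λ r → vertex q (toℕ r) 0 (lt r)) , (λ r → pt-vertex q r 0 (lt r))
          where
          lt : (r : Fin q) → toℕ r + 0 * q < n
          lt r = r+bq<n q (Fin.toℕ<n r) 1≤n/q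

        last-part : Fin q
        last-part = fromℕ< (ℕ.≤-reflexive (ℕ.suc-pred q))

        x : Fin n
        x = proj₁ base last-part

        level≤1 : (i : Fin n) → toℕ i / q ≤ 1
        level≤1 i = subst (toℕ i / q ≤_) n/q≡1 (/-monoˡ-≤ q (ℕ.<⇒≤ (Fin.toℕ<n i)))

        -- Only levels 0 and 1 occur, so a part has at most two elements.
        same-level : {i j k : Fin n} → pt q i ≡ pt q j → pt q i ≡ pt q k → j ≢ i → k ≢ i → j ≡ k
        same-level {i} {j} {k} ij ik j≢i k≢i = part-injective q
          (pt⇒part q {u = j} {k} (trans (sym ij) ik))
          (bits (level≤1 i) (level≤1 j) (level≤1 k)
            (λ e → j≢i (part-injective q (pt⇒part q {u = j} {i} (sym ij)) e))
            (λ e → k≢i (part-injective q (pt⇒part q {u = k} {i} (sym ik)) e)))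
          where
          bits : ∀ {a b c} → a ≤ 1 → b ≤ 1 → c ≤ 1 → b ≢ a → c ≢ a → b ≡ c
          bits z≤n z≤n _ b≢a _ = contradiction refl b≢a
          bits z≤n (s≤s z≤n) z≤n _ c≢a = contradiction refl c≢a
          bits z≤n (s≤s z≤n) (s≤s z≤n) _ _ = refl
          bits (s≤s z≤n) z≤n z≤n _ _ = refl
          bits (s≤s z≤n) z≤n (s≤s z≤n) _ c≢a = contradiction refl c≢a
          bits (s≤s z≤n) (s≤s z≤n) _ b≢a _ = contradiction refl b≢a

        -- As n < 2q, the last residue class has a single element.
        alone : (i : Fin n) → pt q i ≡ last-part → toℕ i / q ≡ 0
        alone i e = ℕ.n<1⇒n≡0 (subst (toℕ i / q <_) n/q≡1 (/-<-/ q (Fin.toℕ<n i)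
          (subst (n % q ≤_) (trans (sym toℕ-last) (trans (sym (cong toℕ e)) (toℕ-pt q i))) (m%n≤pred))))
          where
          toℕ-last : toℕ last-part ≡ pred q
          toℕ-last = Fin.toℕ-fromℕ< _
          m%n≤pred : n % q ≤ pred q
          m%n≤pred = ℕ.<⇒≤pred (m%n<n n q)

        x-alone : ∀ {i} → pt q i ≡ pt q x → i ≡ x
        x-alone {i} e = part-injective q (pt⇒part q {u = i} {x} e)
          (trans (alone i (trans e (proj₂ base last-part))) (sym (alone x (proj₂ base last-part))))

        -- Here `n / q = 1`, so at least `n - 1` vertices are representatives and `u` is the only
        -- exception.
        all-but : ∀ {u} → ¬ R′ u → ∀ i → i ≢ u → R′ i
        all-but {u} ¬Ru i = #-cover (r? ∘ embed) (singleton? u) (λ { Ri refl → ¬Ru Ri })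
          (ℕ.≤-trans n≤reps (ℕ.+-monoʳ-≤ reps (ℕ.≤-trans (ℕ.≤-reflexive n/q≡1) (1≤#singleton u))))

        clash : {z z′ : Fin n} (S : Transversal) → z ≢ z′ → pt q z ≡ pt q z′ → New (col z z′) → R′ z → R′ z′ →
          ¬ (∀ r → r ≢ pt q z → R′ (proj₁ S r))
        clash {z} {z′} S z≢z′ zz′ new Rz Rz′ RS = twin-contradiction (override S z) z′ Rz′
          (override-all R′ S z Rz RS)
          (λ e → z≢z′ (sym (trans e at)))
          (subst New (sym (trans (cong (col z′) at) (EdgeColoredGraph.color-sym G′ z′ z))) new)
          where
          at : proj₁ (override S z) (pt q z′) ≡ z
          at = trans (cong (proj₁ (override S z)) (sym zz′)) (override-at S z)

        -- If the edge of the new color inside a part is uu′, then u and x can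
        -- be exchanged, which makes u a part of its own.
        module Exchange {u u′ : Fin n} (u≢u′ : u ≢ u′) (uu′ : pt q u ≡ pt q u′) (new : New (col u u′)) where

          π : Fin n → Fin n
          π k with k Fin.≟ u | k Fin.≟ x
          ... | yes _ | _ = x
          ... | no _ | yes _ = u
          ... | no _ | no _ = k

          π-u : π u ≡ x
          π-u with u Fin.≟ u
          ... | yes _ = refl
          ... | no ¬e = contradiction refl ¬e

          π-x : π x ≡ u
          π-x with x Fin.≟ u | x Fin.≟ x
          ... | yes e | _ = e
          ... | no _ | yes _ = refl
          ... | no _ | no ¬e = contradiction refl ¬e

          π-other : ∀ {k} → k ≢ u → k ≢ x → π k ≡ k
          π-other {k} k≢u k≢x with k Fin.≟ u | k Fin.≟ x
          ... | yes e | _ = contradiction e k≢u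
          ... | no _ | yes e = contradiction e k≢x
          ... | no _ | no _ = refl

          π-involutive : ∀ k → π (π k) ≡ k
          π-involutive k with k Fin.≟ u | k Fin.≟ x
          ... | yes e | _ = trans π-x (sym e)
          ... | no _ | yes e = trans π-u (sym e)
          ... | no k≢u | no k≢x = π-other k≢u k≢x

          π-injective : ∀ {i j} → π i ≡ π j → i ≡ j
          π-injective e = trans (sym (π-involutive _)) (trans (cong π e) (π-involutive _))

          -- The pairs that may become cross pairs after the exchange: the old cross pairs and `uu′`
          -- in both orders. They still have distinct colors, as that of `uu′` is new.
          data Special (i j : Fin n) : Set where
            cross : pt q i ≢ pt q j → Special i j
            pair  : i ≡ u → j ≡ u′ → Special i j
            pair′ : i ≡ u′ → j ≡ u → Special i j

          -- Pairs without `u` and `x` do not move. A pair containing `u` moves to one containing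
          -- `x`, which is alone in its part. So only a pair that acquires `u` from `x` can end
          -- inside a part, and its other vertex is then the partner `u′`.
          special : ∀ {i j} → pt q i ≢ pt q j → Special (π i) (π j)
          special {i} {j} i≁j = go (pt q (π i) Fin.≟ pt q (π j)) (i Fin.≟ u) (i Fin.≟ x) (j Fin.≟ u) (j Fin.≟ x)
            where
            i≢j : i ≢ j
            i≢j e = i≁j (cong (pt q) e)
            πi≢πj : π i ≢ π j
            πi≢πj e = i≢j (π-injective e)
            go : Dec (pt q (π i) ≡ pt q (π j)) → Dec (i ≡ u) → Dec (i ≡ x) → Dec (j ≡ u) → Dec (j ≡ x) →
                 Special (π i) (π j)
            go (no ¬e) _ _ _ _ = cross ¬e
            go (yes e) (yes refl) _ _ _ = contradiction
              (trans π-u (sym (x-alone (trans (sym e) (cong (pt q) π-u))))) πi≢πj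
            go (yes e) (no _) _ (yes refl) _ = contradiction
              (trans (x-alone (trans e (cong (pt q) π-u))) (sym π-u)) πi≢πj
            go (yes e) (no _) (yes refl) (no _) _ = pair π-x
              (same-level (trans (sym (cong (pt q) π-x)) e) uu′ (λ e′ → πi≢πj (trans π-x (sym e′))) (u≢u′ ∘ sym))
            go (yes e) (no _) (no _) (no _) (yes refl) = pair′
              (same-level (trans (sym (cong (pt q) π-x)) (sym e)) uu′ (λ e′ → πi≢πj (trans e′ (sym π-x))) (u≢u′ ∘ sym)) π-x
            go (yes e) (no i≢u) (no i≢x) (no j≢u) (no j≢x) = contradiction
              (trans (cong (pt q) (sym (π-other i≢u i≢x))) (trans e (cong (pt q) (π-other j≢u j≢x)))) i≁j

          pair-color : ∀ {i j} → i ≡ u′ → j ≡ u → col i j ≡ col u u′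
          pair-color refl refl = EdgeColoredGraph.color-sym G′ u′ u

          special-rainbow : ∀ {i j k l} → Special i j → Special k l → col i j ≡ col k l →
            (i ≡ k × j ≡ l) ⊎ (i ≡ l × j ≡ k)
          special-rainbow (cross a) (cross b) e = rainbow-pt a b e
          special-rainbow (cross a) (pair refl refl) e = contradiction e (new _ _ a)
          special-rainbow (cross a) (pair′ b c) e = contradiction (trans e (pair-color b c)) (new _ _ a)
          special-rainbow (pair refl refl) (cross a) e = contradiction (sym e) (new _ _ a)
          special-rainbow (pair′ b c) (cross a) e = contradiction (trans (sym e) (pair-color b c)) (new _ _ a)
          special-rainbow (pair a b) (pair c d) _ = inj₁ (trans a (sym c) , trans b (sym d))
          special-rainbow (pair a b) (pair′ c d) _ = inj₂ (trans a (sym d) , trans b (sym c))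
          special-rainbow (pair′ a b) (pair c d) _ = inj₂ (trans a (sym d) , trans b (sym c))
          special-rainbow (pair′ a b) (pair′ c d) _ = inj₁ (trans a (sym c) , trans b (sym d))

          exchanged : RainbowCopy (T n q) (del v G)
          exchanged = record
            { embed = embed ∘ π
            ; injective = π-injective ∘ injective
            ; preserves = λ uw → is-complete λ e → uw (cong (part q) (π-injective (injective e)))
            ; rainbow = λ uw xy e → Sum.map
                (λ (a , b) → π-injective a , π-injective b) (λ (a , b) → π-injective a , π-injective b)
                (special-rainbow (special (uw ∘ pt⇒part q)) (special (xy ∘ pt⇒part q)) e)
            }

          extend-exchanged : ¬ R′ u → Extremal q G
          extend-exchanged ¬Ru = extend exchanged (pt q x) λ i e Ri →
            ¬Ru (subst R (cong embed (trans (cong π (x-alone e)) π-x)) Ri)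

      small : Extremal q G
      small = by-missing (Fin.any? λ i → ¬? (r? (embed i)))
        where
        edge = new-color (ℕ.≤-reflexive (trans (ℕ.+-comm 1 (t n q)) (sym #colors)))
        z z′ : Fin n
        z = proj₁ edge
        z′ = proj₁ (proj₂ edge)
        z≢z′ = proj₁ (proj₂ (proj₂ edge))
        zz′ = proj₁ (proj₂ (proj₂ (proj₂ edge)))
        new = proj₂ (proj₂ (proj₂ (proj₂ edge)))
        new′ : New (col z′ z)
        new′ = subst New (EdgeColoredGraph.color-sym G′ z z′) new

        by-missing : Dec (∃ λ i → ¬ R′ i) → Extremal q G
        by-missing (no ∄) = contradiction (λ r _ → all-R (proj₁ base r)) (clash base z≢z′ zz′ new (all-R z) (all-R z′))
          where
          all-R : ∀ i → R′ i
          all-R i = decidable-stable (r? (embed i)) (λ ¬Ri → ∄ (i , ¬Ri))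
        by-missing (yes (u , ¬Ru)) = by-partner (Fin.any? λ i → ¬? (i Fin.≟ u) ×-dec (pt q i Fin.≟ pt q u))
          where
          by-partner : Dec (∃ λ i → i ≢ u × pt q i ≡ pt q u) → Extremal q G
          by-partner (no ∄) = extend turán (pt q u) λ i e Ri →
            ∄ (i , (λ { refl → ¬Ru Ri }) , e)
          by-partner (yes (u′ , u′≢u , u′u)) = by-edge (z Fin.≟ u) (z′ Fin.≟ u)
            where
            by-edge : Dec (z ≡ u) → Dec (z′ ≡ u) → Extremal q G
            by-edge (yes refl) _ = Exchange.extend-exchanged z≢z′ zz′ new ¬Ru
            by-edge (no _) (yes refl) = Exchange.extend-exchanged (z≢z′ ∘ sym) (sym zz′) new′ ¬Ru
            -- The partner `u′` replaces `u` in the transversal. As `u` is the only vertex that is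
            -- not a representative, the transversal and `zz′` consist of representatives.
            by-edge (no z≢u) (no z′≢u) = contradiction
              (λ r _ → override-all R′ base u′ (all-but ¬Ru u′ u′≢u)
                (λ r′ r′≢ → all-but ¬Ru (proj₁ base r′)
                  (λ e → r′≢ (trans (sym (proj₂ base r′)) (trans (cong (pt q) e) (sym u′u))))) r)
              (clash (override base u′) z≢z′ zz′ new (all-but ¬Ru z z≢u) (all-but ¬Ru z′ z′≢u))

  -- The base case of q + 1 vertices

  module _ (G : EdgeColoredGraph (suc q)) (m+c≥ : suc q C 2 + t (suc q) q + 1 ≤ m[ G ] + c[ G ]) where
    private
      -- The Turán graph on `suc q` vertices lacks a single edge, namely the one inside its only
      -- part of two vertices. The threshold is therefore twice the number of pairs, which forces
      -- both `m[ G ]` and `c[ G ]` to be maximal.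
      t+1 : t (suc q) q + 1 ≡ suc q C 2
      t+1 = base-arith (subst (λ x → 2 * t (suc x) q + (suc x * 1 + 2) ≡ suc x * suc x) (ℕ.+-identityʳ q)
        (t-closed q 1 1 (ℕ.<⇒≤ (ℕ.<-≤-trans (s≤s (s≤s z≤n)) 4≤q)))) (2C2 (suc q))
        where
        base-arith : ∀ {t b n} → 2 * t + (n * 1 + 2) ≡ n * n → 2 * b + n ≡ n * n → t + 1 ≡ b
        base-arith {t} {b} {n} e₁ e₂ = ℕ.*-cancelˡ-≡ (t + 1) b 2
          (ℕ.+-cancelʳ-≡ n (2 * (t + 1)) (2 * b) (trans (e t n) (trans e₁ (sym e₂))))
          where
          e : ∀ t n → 2 * (t + 1) + n ≡ 2 * t + (n * 1 + 2)
          e = solve-∀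

      sum≥ : suc q C 2 + suc q C 2 ≤ m[ G ] + c[ G ]
      sum≥ = subst (_≤ m[ G ] + c[ G ])
        (trans (ℕ.+-assoc (suc q C 2) _ 1) (cong (suc q C 2 +_) t+1)) m+c≥

      both-max : ∀ {m c b} → m ≤ b → c ≤ m → b + b ≤ m + c → b ≤ m × b ≤ c
      both-max {m} {c} {b} m≤b c≤m b+b≤ =
        ℕ.+-cancelʳ-≤ b b m (ℕ.≤-trans b+b≤ (ℕ.+-monoʳ-≤ m (ℕ.≤-trans c≤m m≤b))) ,
        ℕ.+-cancelˡ-≤ b b c (ℕ.≤-trans b+b≤ (ℕ.+-monoˡ-≤ c m≤b))

      maxed : suc q C 2 ≤ m[ G ] × suc q C 2 ≤ c[ G ]
      maxed = both-max (m≤C2 G) (c≤m G) sum≥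

      open EdgeColoredGraph G using (color; edges)

      compl : Complete G
      compl = complete G (proj₁ maxed)

      edge∈ : ∀ {u v} → u F.< v → (u , v) ∈ edges
      edge∈ u<v = ∈edges⁺ (EdgeColoredGraph.graph G) u<v (compl (Fin.<⇒≢ u<v))

    extremal-base : Extremal q G
    extremal-base = record
      { is-complete = compl
      ; #colors = trans (ℕ.≤-antisym (ℕ.≤-trans (c≤m G) (m≤C2 G)) (proj₂ maxed)) (sym t+1)
      ; turán = record
        { embed = id
        ; injective = id
        ; preserves = λ uv → compl (λ e → uv (cong (part q) e))
        ; rainbow = rainbow-ordered (T (suc q) q) G id λ u<v x<y _ _ e →
            ,-injective (m≤c⇒injective G (ℕ.≤-trans (m≤C2 G) (proj₂ maxed)) (edge∈ u<v) (edge∈ x<y) e)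
        }
      }

  -- Induction on the number of vertices

  Extremality : ℕ → Set₁
  Extremality n = (G : EdgeColoredGraph n) → n C 2 + t n q + 1 ≤ m[ G ] + c[ G ] →
    ¬ RainbowCopy (K (2 + q)) G → Extremal q G

  private
    module Deletion (q<n : q < n) (hyp : Extremality n) (G : EdgeColoredGraph (suc n))
                    (m+c≥ : suc n C 2 + t (suc n) q + 1 ≤ m[ G ] + c[ G ])
                    (no-copy : ¬ RainbowCopy (K (2 + q)) G) (v : Fin (suc n))
                    (cheap : lostEdges G v + lostColors G v + (n C 2 + t n q) < m[ G ] + c[ G ]) where

      m+c-del≥ : n C 2 + t n q + 1 ≤ m[ del v G ] + c[ del v G ]
      m+c-del≥ = descent-arith {m[ del v G ]} {c[ del v G ]} {m[ G ]} {c[ G ]} {lostEdges G v} {lostColors G v}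
        {n C 2 + t n q} cheap (m≤m-del G v) (c≤c-del G v)

      ext : Extremal q (del v G)
      ext = hyp (del v G) m+c-del≥ (no-copy ∘ pullback-copy (Fin.punchIn-injective v _ _))

      losses : n + n ≤ lostEdges G v + (lostColors G v + n / q)
      losses = loss-arith {m[ del v G ]} {c[ del v G ]} {m[ G ]} {c[ G ]} {lostEdges G v} {lostColors G v}
        {n C 2} {suc n C 2} {n} {t n q} {t (suc n) q} {n / q}
        (m≤C2 (del v G)) (Extremal.#colors ext) (C2-suc n) (t-suc q n) (m≤m-del G v) (c≤c-del G v) m+c≥

      1≤n/q : 1 ≤ n / q
      1≤n/q = m≥n⇒m/n>0 (ℕ.<⇒≤ q<n)

      open Step G v 1≤n/q ext no-copy m+c≥ losses

      by-level : Dec (2 ≤ n / q) → Extremal q G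
      by-level (yes 2≤) = large 2≤
      by-level (no ≱2) = Small.small (ℕ.≤-antisym (ℕ.≤-pred (ℕ.≰⇒> ≱2)) 1≤n/q)

  extremal : ∀ n → suc q ≤ n → Extremality n
  extremal (suc n) (s≤s q≤n) G m+c≥ no-copy = by-size (ℕ.m≤n⇒m<n∨m≡n q≤n)
    where
    by-size : q < n ⊎ q ≡ n → Extremal q G
    by-size (inj₁ q<n) =
      let v , cheap = cheap-vertex q G q<n m+c≥ in
      Deletion.by-level q<n (extremal n q<n) G m+c≥ no-copy v cheap (2 ≤? n / q)
    by-size (inj₂ refl) = extremal-base G m+c≥

-- The two types, distinguished by the size of the parts

theorem6 : (n k : ℕ) → k ≤ n → (6≤k : 6 ≤ k) →
    let instance k∸2≢0 = 6≤k⇒k∸2≢0 6≤k in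
    (G : EdgeColoredGraph n) →
    m[ G ] + c[ G ] ≡ n C 2 + t n (k ∸ 2) + 1 →
    ¬ RainbowCopy (K k) G →
    G ∈𝓗 k
theorem6 n (suc (suc q)) k≤n (s≤s (s≤s 4≤q)) G m+c≡ no-copy = by-level (2 ≤? n / q)
  where
  instance
    q≢0 : NonZero q
    q≢0 = 6≤k⇒k∸2≢0 (s≤s (s≤s 4≤q))
  open Extremal (extremal q 4≤q n (ℕ.≤-trans (ℕ.n≤1+n (suc q)) k≤n) G (ℕ.≤-reflexive (sym m+c≡)) no-copy)
  1≤n/q : 1 ≤ n / q
  1≤n/q = m≥n⇒m/n>0 (ℕ.≤-trans (ℕ.m≤n+m q 2) k≤n)
  by-level : Dec (2 ≤ n / q) → G ∈𝓗 suc (suc q)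
  by-level (no ≱2) = inj₂ (ℕ.≤-antisym (ℕ.≤-pred (ℕ.≰⇒> ≱2)) 1≤n/q , is-complete , #colors , turán , no-copy)
  by-level (yes 2≤) =
    -- With two vertices in every part, the single remaining color fills all parts, which is the
    -- structure of type (I).
    let _ , new , inside = Positions.monochromatic q G is-complete turán 4≤q 2≤ #colors no-copy in
    inj₁ (Positions.turán-iso q G is-complete turán new inside)
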